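{- Let $n,k$ be given positive integers with $1\le k\le n-2$, and let $\overrightarrow{G}\in\Omega(n,k)$. Then: (i) $$\rho(\overrightarrow{G})\le \frac{n-2+\sqrt{(n-2)^2+4k}}{2},$$ with equality if and only if $\overrightarrow{G}\cong\overrightarrow{K}(n,k,1)$ or $\overrightarrow{G}\cong\overrightarrow{K}(n,k,n-k-1)$. (ii) $$q(\overrightarrow{G})\le \frac{2n+k-3+\sqrt{(2n-k-3)^2+4k}}{2},$$ with equality if and only if $\overrightarrow{G}\cong\overrightarrow{K}(n,k,n-k-1)$. (iii) $$\rho^{\mathcal D}(\overrightarrow{G})\ge \frac{n-2+\sqrt{(n+2)^2-4k-8}}{2},$$ with equality if and only if $\overrightarrow{G}\cong\overrightarrow{K}(n,k,1)$ or $\overrightarrow{G}\cong\overrightarrow{K}(n,k,n-k-1)$. (iv) $$q^{\mathcal D}(\overrightarrow{G})\ge \frac{3n-3+\sqrt{(n+3)^2-8k-16}}{2},$$ with equality if and only if $\overrightarrow{G}\cong\overrightarrow{K}(n,k,1)$.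
   Context: Digraphs are finite and simple (no loops, no multiple arcs; a pair of opposite arcs is allowed). The spectral radius of a matrix is the largest modulus of its eigenvalues. For a strongly connected digraph $\overrightarrow{G}$ with vertices $v_1,\dots,v_n$: $A(\overrightarrow G)$ is the adjacency matrix ($a_{ij}=1$ if $(v_i,v_j)$ is an arc, else $0$) and $\rho(\overrightarrow G)$ is its spectral radius; $Q(\overrightarrow G)=\mathrm{diag}(d_1^+,\dots,d_n^+)+A(\overrightarrow G)$, with $d_i^+$ the outdegree of $v_i$, is the signless Laplacian matrix and $q(\overrightarrow G)$ is its spectral radius; $\mathcal D(\overrightarrow G)$ is the distance matrix, whose $(i,j)$ entry is the length of a shortest directed path from $v_i$ to $v_j$, and $\rho^{\mathcal D}(\overrightarrow G)$ is its spectral radius; $Tr(\overrightarrow G)$ is the diagonal matrix of row sums of $\mathcal D(\overrightarrow G)$; $\mathcal Q(\overrightarrow G)=Tr(\overrightarrow G)+\mathcal D(\overrightarrow G)$ is the distance signless Laplacian matrix and $q^{\mathcal D}(\overrightarrow G)$ is its spectral radius. The vertex connectivity $\kappa(\overrightarrow G)$ of a strongly connected digraph is the minimum number of vertices whose deletion makes the digraph not strongly connected (for the complete digraph on $n$ vertices it is $n-1$). $\Omega(n,k)$ is the set of all simple strongly connected digraphs on $n$ vertices with vertex connectivity $k$. For $1\le k\le n-2$ and $1\le p\le n-k-1$, $\overrightarrow K(n,k,p)$ is the digraph whose vertex set is a disjoint union of sets $P,S,R$ with $|P|=p$, $|S|=k$, $|R|=n-p-k$, and whose arcs are all ordered pairs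 $(u,v)$ of distinct vertices except those with $u\in R$ and $v\in P$. -}

module Defs where

open import Level using (0ℓ) renaming (suc to lsuc)
open import Algebra.Bundles using (CommutativeRing; Semiring)
open import Data.Bool using (Bool; true; false; not; _∧_; if_then_else_; T)
open import Data.Nat using (ℕ; suc; _∸_)
import Data.Nat as ℕ
open import Data.Fin using (Fin; zero; suc; toℕ; fromℕ; inject₁; _≟_)
open import Data.Fin.Subset using (Subset; _∉_; ∣_∣)
open import Data.Fin.Permutation using (Permutation; _⟨$⟩ʳ_)
open import Data.Vec using (tabulate)
open import Data.Vec.Functional using (Vector; foldr)
open import Data.Product using (Σ-syntax; ∃-syntax; _×_)
open import Data.Sum using (_⊎_)
open import Function.Definitions using (Injective)
open import Relation.Binary.Core using (Rel)
open import Relation.Binary.Structures using (IsDecTotalOrder)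
open import Relation.Binary.Construct.Closure.ReflexiveTransitive using (Star)
open import Relation.Binary.PropositionalEquality using (_≡_; _≢_; refl)
open import Relation.Nullary using (¬_; does; yes; no; contradiction)

import Algebra.Definitions.RawSemiring as RawSemiringDefs

-- The real numbers, axiomatised up to isomorphism as a Dedekind-complete
-- ordered field.  The theory is classical: order and equality are decidable,
-- and the inverse is total, with an unspecified value at zero.
record CompleteOrderedField : Set₁ where
  field
    commutativeRing : CommutativeRing 0ℓ 0ℓ

  open CommutativeRing commutativeRing public

  infix 4 _≤_
  infix 8 _⁻¹

  field
    _≤_             : Rel Carrier 0ℓ
    isDecTotalOrder : IsDecTotalOrder _≈_ _≤_
    _⁻¹             : Carrier → Carrier
    0≉1             : ¬ 0# ≈ 1#
    ⁻¹-inverse      : ∀ x → ¬ x ≈ 0# → x * x ⁻¹ ≈ 1#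
    +-monoˡ-≤       : ∀ x y z → x ≤ y → x + z ≤ y + z
    *-nonneg        : ∀ x y → 0# ≤ x → 0# ≤ y → 0# ≤ x * y

  UpperBound : (Carrier → Set) → Carrier → Set
  UpperBound P b = ∀ x → P x → x ≤ b

  field
    supremum : (P : Carrier → Set) →
               (∃[ x ] P x) → (∃[ b ] UpperBound P b) →
               ∃[ s ] (UpperBound P s × (∀ b → UpperBound P b → s ≤ b))

  open RawSemiringDefs (Semiring.rawSemiring semiring) public
    using (_^_; sum) renaming (_×_ to _·_)

  infixl 7 _/_

  _/_ : Carrier → Carrier → Carrier
  x / y = x * y ⁻¹

  ι : ℕ → Carrier
  ι n = n · 1#

  IsSqrt : Carrier → Carrier → Set
  IsSqrt x s = 0# ≤ s × s * s ≈ x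

record Digraph (n : ℕ) : Set where
  field
    arc      : Fin n → Fin n → Bool
    loopless : ∀ v → arc v v ≡ false

open Digraph public

Arc : ∀ {n} → Digraph n → Rel (Fin n) 0ℓ
Arc G u v = T (arc G u v)

outdegree : ∀ {n} → Digraph n → Fin n → ℕ
outdegree G u = ∣ tabulate (arc G u) ∣

infix 4 _≅_

_≅_ : ∀ {m n} → Digraph m → Digraph n → Set
_≅_ {m} {n} G H =
  Σ[ π ∈ Permutation m n ] (∀ u v → arc G u v ≡ arc H (π ⟨$⟩ʳ u) (π ⟨$⟩ʳ v))

StronglyConnected : ∀ {n} → Digraph n → Set
StronglyConnected G = ∀ u v → Star (Arc G) u v

-- The arcs of the digraph that remains when the vertices in X are deleted.
ArcOff : ∀ {n} → Digraph n → Subset n → Rel (Fin n) 0ℓ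
ArcOff G X u v = u ∉ X × v ∉ X × Arc G u v

StronglyConnectedOff : ∀ {n} → Digraph n → Subset n → Set
StronglyConnectedOff G X = ∀ u v → u ∉ X → v ∉ X → Star (ArcOff G X) u v

Complete : ∀ {n} → Digraph n → Set
Complete G = ∀ u v → u ≢ v → Arc G u v

MinimumCut : ∀ {n} → Digraph n → ℕ → Set
MinimumCut G k =
  (∃[ X ] (∣ X ∣ ≡ k × ¬ StronglyConnectedOff G X)) ×
  (∀ X → ¬ StronglyConnectedOff G X → k ℕ.≤ ∣ X ∣)

VertexConnectivity : ∀ {n} → Digraph n → ℕ → Set
VertexConnectivity {n} G k =
  (Complete G × k ≡ n ∸ 1) ⊎ (¬ Complete G × MinimumCut G k)

record _∈Ω[_] {n} (G : Digraph n) (k : ℕ) : Set where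
  field
    stronglyConnected  : StronglyConnected G
    vertexConnectivity : VertexConnectivity G k

record Path {n} (G : Digraph n) (u v : Fin n) (length : ℕ) : Set where
  field
    vertex   : Vector (Fin n) (suc length)
    distinct : Injective _≡_ _≡_ vertex
    start    : vertex zero ≡ u
    end      : vertex (fromℕ length) ≡ v
    arcs     : ∀ i → Arc G (vertex (inject₁ i)) (vertex (suc i))

IsDistance : ∀ {n} → Digraph n → (Fin n → Fin n → ℕ) → Set
IsDistance G d = ∀ u v →
  Path G u v (d u v) × (∀ ℓ → Path G u v ℓ → d u v ℕ.≤ ℓ)

-- P consists of the first p vertices, S of the next k, and R of the others.
K : (n k p : ℕ) → Digraph n
K n k p = record { arc = arcK ; loopless = looplessK }
  where
  inP inR : Fin n → Bool
  inP v = does (toℕ v ℕ.<? p)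
  inR v = does (p ℕ.+ k ℕ.≤? toℕ v)

  arcK : Fin n → Fin n → Bool
  arcK u v = not (does (u ≟ v)) ∧ not (inR u ∧ inP v)

  looplessK : ∀ v → arcK v v ≡ false
  looplessK v with v ≟ v
  ... | yes _  = refl
  ... | no v≢v = contradiction refl v≢v

module Spectral (ℝ : CompleteOrderedField) where
  open CompleteOrderedField ℝ

  infix  4 _≈ℂ_
  infixl 6 _+ℂ_
  infixl 7 _*ℂ_

  record ℂ : Set where
    constructor _+i_
    field
      re im : Carrier

  open ℂ public

  _≈ℂ_ : ℂ → ℂ → Set
  w ≈ℂ z = re w ≈ re z × im w ≈ im z

  _+ℂ_ _*ℂ_ : ℂ → ℂ → ℂ
  w +ℂ z = (re w + re z) +i (im w + im z)
  w *ℂ z = (re w * re z - im w * im z) +i (re w * im z + im w * re z)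

  fromReal : Carrier → ℂ
  fromReal x = x +i 0#

  IsModulus : ℂ → Carrier → Set
  IsModulus z r = IsSqrt (re z ^ 2 + im z ^ 2) r

  Matrix : ℕ → Set
  Matrix n = Fin n → Fin n → Carrier

  _*ᵥ_ : ∀ {n} → Matrix n → Vector ℂ n → Vector ℂ n
  (M *ᵥ x) i = foldr _+ℂ_ (fromReal 0#) (λ j → fromReal (M i j) *ℂ x j)

  IsEigenvalue : ∀ {n} → Matrix n → ℂ → Set
  IsEigenvalue {n} M z = Σ[ x ∈ Vector ℂ n ]
    (¬ (∀ i → x i ≈ℂ fromReal 0#) × (∀ i → (M *ᵥ x) i ≈ℂ z *ℂ x i))

  IsSpectralRadius : ∀ {n} → Matrix n → Carrier → Set
  IsSpectralRadius M ρ =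
    (∃[ z ] (IsEigenvalue M z × IsModulus z ρ)) ×
    (∀ z r → IsEigenvalue M z → IsModulus z r → r ≤ ρ)

  diag : ∀ {n} → Vector Carrier n → Matrix n
  diag d i j = if does (i ≟ j) then d i else 0#

  _+ₘ_ : ∀ {n} → Matrix n → Matrix n → Matrix n
  (M +ₘ N) i j = M i j + N i j

  adjacency : ∀ {n} → Digraph n → Matrix n
  adjacency G i j = if arc G i j then 1# else 0#

  signlessLaplacian : ∀ {n} → Digraph n → Matrix n
  signlessLaplacian G = diag (λ i → ι (outdegree G i)) +ₘ adjacency G

  -- These two take the distance function d of the digraph, as characterised
  -- by IsDistance.
  distance : ∀ {n} → (Fin n → Fin n → ℕ) → Matrix n
  distance d i j = ι (d i j)

  distanceSignlessLaplacian : ∀ {n} → (Fin n → Fin n → ℕ) → Matrix n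
  distanceSignlessLaplacian d = diag (λ i → sum (distance d i)) +ₘ distance d

{-# OPTIONS --safe #-}

-- A cut of size k makes the digraph a spanning subgraph of some K n k p, with blocks P, S, R of
-- sizes p, k, r.  Take the vector x equal to 1 on P and S and to a suitable a > 0 on R: for the
-- matrix of K n k p, it satisfies M x = l x + excess with a constant vector excess, where l is the
-- claimed bound and the sign of excess is that of a product such as (p - 1)(r - 1).
-- Entrywise comparison gives M x ≤ l x for the two adjacency matrices, and M x ≥ l x for the two
-- distance matrices, of the given digraph.  The first bounds the modulus of every eigenvalue,
-- as one sees at an index where the eigenvector is largest relative to x; the second produces an
-- eigenvalue ≥ l, namely the infimum of all t such that M y < t y for some y > 0.
-- In the case of equality M x = l x, so that the entries agree with those of K n k p and excess = 0.

module Submission where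

open import Defs
open import Algebra.Solver.Ring.AlmostCommutativeRing
  using (fromCommutativeRing; _-Raw-AlmostCommutative⟶_)
open import Data.Bool using (Bool; true; false; not; _∧_; if_then_else_; T)
open import Data.Empty using (⊥; ⊥-elim)
open import Data.Fin using (Fin; zero; suc; toℕ; fromℕ<; punchIn; punchOut; _≟_)
open import Data.Fin.Permutation as Perm using (Permutation; _⟨$⟩ʳ_; insert; insert-punchIn)
open import Data.Fin.Subset using (Subset; _∈_; _∉_; _∪_; ⁅_⁆; ∣_∣; _⊃_)
open import Data.Fin.Subset.Induction using (⊃-wellFounded; Acc; acc)
open import Data.Fin.Subset.Properties using (_∈?_; p⊆p∪q; q⊆p∪q; x∈⁅x⁆; x∈⁅y⁆⇒x≡y; x∈p∪q⁻)
open import Data.Maybe using (Maybe; just; nothing)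
open import Data.Nat using (ℕ; suc; zero; _∸_)
open import Data.Product using (Σ-syntax; ∃-syntax; _×_; _,_; proj₁; proj₂)
open import Data.Sum using (_⊎_; inj₁; inj₂; [_,_]′)
open import Data.Unit using (tt)
open import Data.Vec using ([]; _∷_; here; there; tabulate)
open import Data.Vec.Functional using (Vector; foldr) renaming (_∷_ to _∷ᶠ_)
open import Function using (_∘_)
open import Function.Bundles using (_⇔_; mk⇔; Equivalence; Injection)
open import Function.Construct.Composition using (_⇔-∘_)
open import Function.Properties.Inverse using (↔⇒↣)
open import Relation.Binary.Construct.Closure.ReflexiveTransitive as Star using (Star; ε; _◅_; _◅◅_)
open import Relation.Binary.PropositionalEquality as ≡ using (_≡_; _≢_)
open import Relation.Binary.Structures using (IsDecTotalOrder)
open import Relation.Nullary using (¬_; Dec; yes; no; does; ¬?; contradiction)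
open import Relation.Nullary.Decidable using (_×-dec_; T?; dec-true; dec-false)
import Algebra.Properties.Ring as RingProperties
import Algebra.Properties.Semiring.Mult as MultProperties
import Algebra.Properties.Semiring.Sum as SumProperties
import Algebra.Solver.Ring as RingSolver
import Data.Fin.Properties as Finₚ
import Data.Integer as ℤ
import Data.Integer.Properties as ℤₚ
import Data.Nat as Nat
import Data.Nat.Properties as ℕₚ
import Data.Sum as Sum

-- In K(n,k,p) the vertices of P and S all have arcs to every other vertex, so one value serves both
-- classes and only `a` on R is free. The bound `l` is prescribed independently of p, so the two
-- kinds of rows cannot both be solved exactly; `a` is chosen to give them the same error, the
-- number `excess`. The shifted bound `m` is a root of a quadratic in n and k alone. Modulo this
-- quadratic, `excess` times a positive denominator is -(p-1)(r-1), -(2p+n-2-m)(r-1), (p-1)(r-1) or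
-- (m+n-2p-2-2k)(p-1) in parts (i) to (iv). The long factors are positive, so these products fix the
-- direction of each bound and single out its extremal sizes. A lower bound on the radius needs an
-- eigenvalue to exist, and a row inequality exhibits none; hence the Perron argument from
-- completeness and elimination. It serves all four parts, since attaining an upper bound is itself
-- a lower bound. In the equality cases the adjacency matrices vanish off the arcs, so strong
-- connectivity has to spread tightness from one row to all; off-diagonal distances are positive,
-- and one application of the matrix suffices.

module Combinatorics where
  open import Data.Nat using (_+_; _≤_; _≤ᵇ_; _<ᵇ_; z≤n; s≤s; _≤?_; _<?_)
  open ≡ using (refl; sym; trans; cong; cong₂; subst)
  open import Algebra.Properties.CommutativeMonoid.Sum ℕₚ.+-0-commutativeMonoid
    using (sum; sum-remove; sum-permute)

  -- Colour classes and their sizes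

  data Colour : Set where
    P S R : Colour

  _≟ᶜ_ : (c d : Colour) → Dec (c ≡ d)
  P ≟ᶜ P = yes refl
  P ≟ᶜ S = no λ ()
  P ≟ᶜ R = no λ ()
  S ≟ᶜ P = no λ ()
  S ≟ᶜ S = yes refl
  S ≟ᶜ R = no λ ()
  R ≟ᶜ P = no λ ()
  R ≟ᶜ S = no λ ()
  R ≟ᶜ R = yes refl

  tally : Colour → Colour → ℕ
  tally c d = if does (c ≟ᶜ d) then 1 else 0

  tally-≡ : ∀ c → tally c c ≡ 1
  tally-≡ P = refl
  tally-≡ S = refl
  tally-≡ R = refl

  tally-≢ : ∀ {c d} → c ≢ d → tally c d ≡ 0
  tally-≢ {c} {d} c≢d rewrite dec-false (c ≟ᶜ d) c≢d = refl

  count : ∀ {n} → Colour → (Fin n → Colour) → ℕ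
  count c f = sum (λ i → tally c (f i))

  count-absent : ∀ {n} c (f : Fin n → Colour) → (∀ i → f i ≢ c) → count c f ≡ 0
  count-absent {zero}  c f absent = refl
  count-absent {suc n} c f absent =
    cong₂ _+_ (tally-≢ (absent zero ∘ sym)) (count-absent c (f ∘ suc) (absent ∘ suc))

  count-present : ∀ {n} c (f : Fin n → Colour) i → f i ≡ c → 1 ≤ count c f
  count-present c f zero    refl rewrite tally-≡ (f zero) = s≤s z≤n
  count-present c f (suc i) fi≡c = ℕₚ.≤-trans (count-present c (f ∘ suc) i fi≡c) (ℕₚ.m≤n+m _ (tally c (f zero)))

  count-remove : ∀ {n} c (f : Fin (suc n) → Colour) i → count c f ≡ tally c (f i) + count c (f ∘ punchIn i)
  count-remove c f i = sum-remove {i = i} (tally c ∘ f)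

  count-total : ∀ {n} (f : Fin n → Colour) → count P f + (count S f + count R f) ≡ n
  count-total {zero}  f = refl
  count-total {suc n} f with f zero
  ... | P = cong suc (count-total (f ∘ suc))
  ... | S = trans (ℕₚ.+-suc (count P (f ∘ suc)) _) (cong suc (count-total (f ∘ suc)))
  ... | R = trans (cong (count P (f ∘ suc) +_) (ℕₚ.+-suc (count S (f ∘ suc)) _))
              (trans (ℕₚ.+-suc (count P (f ∘ suc)) _) (cong suc (count-total (f ∘ suc))))

  count-pos⇒present : ∀ {n} c (f : Fin n → Colour) → 1 ≤ count c f → ∃[ i ] f i ≡ c
  count-pos⇒present c f 1≤count with Finₚ.any? (λ i → f i ≟ᶜ c)
  ... | yes present = present
  ... | no  absent  = contradiction (subst (1 ≤_) (count-absent c f (λ i fi≡c → absent (i , fi≡c))) 1≤count) λ ()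

  -- Vertex zero is matched with some vertex of its colour under `g`; deleting both leaves equal
  -- counts. Hence models with equal class sizes are isomorphic.
  same-counts⇒permutation : ∀ {n} (f g : Fin n → Colour) → (∀ c → count c f ≡ count c g) →
                            ∃[ π ] (∀ i → f i ≡ g (π ⟨$⟩ʳ i))
  same-counts⇒permutation {zero}  f g same = Perm.id , λ ()
  same-counts⇒permutation {suc n} f g same
    with count-pos⇒present (f zero) g (subst (1 ≤_) (same (f zero)) (count-present (f zero) f zero refl))
  ... | j , gj≡f0 with same-counts⇒permutation (f ∘ suc) (g ∘ punchIn j) same-rest
    where
    same-rest : ∀ c → count c (f ∘ suc) ≡ count c (g ∘ punchIn j)
    same-rest c = ℕₚ.+-cancelˡ-≡ (tally c (f zero)) _ _
      (trans (same c) (trans (count-remove c g j) (cong (λ d → tally c d + count c (g ∘ punchIn j)) gj≡f0)))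
  ...   | π , f≡gπ = insert zero j π , λ
    { zero    → sym gj≡f0
    ; (suc i) → trans (f≡gπ i) (cong g (sym (insert-punchIn zero j π i)))
    }

  -- The digraphs K n k p in terms of vertex colourings

  isP isR : Colour → Bool
  isP c = does (c ≟ᶜ P)
  isR c = does (c ≟ᶜ R)

  modelArc : ∀ {n} → (Fin n → Colour) → Fin n → Fin n → Bool
  modelArc f u v = not (does (u ≟ v)) ∧ not (isR (f u) ∧ isP (f v))

  -- Peeling off `p`, `k` and `m` together, rather than comparing `m` with `p` and `p + k`, lets the
  -- class sizes over `Fin (p + (k + r))` be computed by the same recursion.
  blockColour : ℕ → ℕ → ℕ → Colour
  blockColour zero    zero    m       = R
  blockColour zero    (suc k) zero    = S
  blockColour zero    (suc k) (suc m) = blockColour zero k m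
  blockColour (suc p) k       zero    = P
  blockColour (suc p) k       (suc m) = blockColour p k m

  isP-blockColour : ∀ p k m → does (m <? p) ≡ isP (blockColour p k m)
  isP-blockColour zero    zero    m       = refl
  isP-blockColour zero    (suc k) zero    = refl
  isP-blockColour zero    (suc k) (suc m) = isP-blockColour zero k m
  isP-blockColour (suc p) k       zero    = refl
  isP-blockColour (suc p) k       (suc m) = isP-blockColour p k m

  suc-≤ᵇ : ∀ a m → (a <ᵇ suc m) ≡ (a ≤ᵇ m)
  suc-≤ᵇ zero    m = refl
  suc-≤ᵇ (suc a) m = refl

  isR-blockColour : ∀ p k m → does (p + k ≤? m) ≡ isR (blockColour p k m)
  isR-blockColour zero    zero    m       = refl
  isR-blockColour zero    (suc k) zero    = refl
  isR-blockColour zero    (suc k) (suc m) = trans (suc-≤ᵇ k m) (isR-blockColour zero k m)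
  isR-blockColour (suc p) k       zero    = refl
  isR-blockColour (suc p) k       (suc m) = trans (suc-≤ᵇ (p + k) m) (isR-blockColour p k m)

  K-colour : ∀ {n} → ℕ → ℕ → Fin n → Colour
  K-colour p k v = blockColour p k (toℕ v)

  arc-K : ∀ n k p u v → arc (K n k p) u v ≡ modelArc (K-colour p k) u v
  arc-K n k p u v rewrite isP-blockColour p k (toℕ v) | isR-blockColour p k (toℕ u) = refl

  size : ℕ → ℕ → ℕ → Colour → ℕ
  size p k r P = p
  size p k r S = k
  size p k r R = r

  HasSizes : ∀ {n} → ℕ → ℕ → ℕ → (Fin n → Colour) → Set
  HasSizes p k r f = ∀ c → count c f ≡ size p k r c

  K-colour-sizes : ∀ p k r → HasSizes p k r (K-colour {p + (k + r)} p k)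
  K-colour-sizes zero    zero    r c = all-R r c
    where
    all-R : ∀ r → HasSizes 0 0 r (λ (_ : Fin r) → R)
    all-R r       P = count-absent {r} P (λ _ → R) (λ _ ())
    all-R r       S = count-absent {r} S (λ _ → R) (λ _ ())
    all-R zero    R = refl
    all-R (suc r) R = cong suc (all-R r R)
  K-colour-sizes zero    (suc k) r P = K-colour-sizes zero k r P
  K-colour-sizes zero    (suc k) r S = cong suc (K-colour-sizes zero k r S)
  K-colour-sizes zero    (suc k) r R = K-colour-sizes zero k r R
  K-colour-sizes (suc p) k       r P = cong suc (K-colour-sizes p k r P)
  K-colour-sizes (suc p) k       r S = K-colour-sizes p k r S
  K-colour-sizes (suc p) k       r R = K-colour-sizes p k r R

  IsModel : ∀ {n} → Digraph n → (Fin n → Colour) → Set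
  IsModel G f = ∀ u v → arc G u v ≡ modelArc f u v

  does-≟-injective : ∀ {m n} (π : Permutation m n) u v → does (u ≟ v) ≡ does (π ⟨$⟩ʳ u ≟ π ⟨$⟩ʳ v)
  does-≟-injective π u v with u ≟ v
  ... | yes refl = sym (dec-true (π ⟨$⟩ʳ u ≟ π ⟨$⟩ʳ v) refl)
  ... | no  u≢v  = sym (dec-false (π ⟨$⟩ʳ u ≟ π ⟨$⟩ʳ v) (u≢v ∘ Injection.injective (↔⇒↣ π)))

  modelArc-permute : ∀ {m n} (π : Permutation m n) f u v →
                     modelArc (f ∘ (π ⟨$⟩ʳ_)) u v ≡ modelArc f (π ⟨$⟩ʳ u) (π ⟨$⟩ʳ v)
  modelArc-permute π f u v =
    cong (λ b → not b ∧ not (isR (f (π ⟨$⟩ʳ u)) ∧ isP (f (π ⟨$⟩ʳ v)))) (does-≟-injective π u v)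

  ≅K⇒model : ∀ {n} (G : Digraph n) p k r → n ≡ p + (k + r) → G ≅ K n k p →
             ∃[ f ] (HasSizes p k r f × IsModel G f)
  ≅K⇒model G p k r refl (π , same) =
    K-colour p k ∘ (π ⟨$⟩ʳ_) ,
    (λ c → trans (sym (sum-permute (tally c ∘ K-colour p k) π)) (K-colour-sizes p k r c)) ,
    (λ u v → trans (same u v) (trans (arc-K _ k p (π ⟨$⟩ʳ u) (π ⟨$⟩ʳ v)) (sym (modelArc-permute π (K-colour p k) u v))))

  model⇒≅K : ∀ {n} (G : Digraph n) p k r f → HasSizes p k r f → IsModel G f → G ≅ K n k p
  model⇒≅K G p k r f sizes model with trans (sym (count-total f)) (cong₂ _+_ (sizes P) (cong₂ _+_ (sizes S) (sizes R)))
  -- The class sizes force `n` to be `p + (k + r)`, the length at which the sizes of `K-colour` are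
  -- known.
  ... | refl with same-counts⇒permutation f (K-colour p k) (λ c → trans (sizes c) (sym (K-colour-sizes p k r c)))
  ...   | π , f≡ = π , λ u v → begin
    arc G u v                                             ≡⟨ model u v ⟩
    modelArc f u v                                        ≡⟨ cong₂ (λ c d → not (does (u ≟ v)) ∧ not (isR c ∧ isP d)) (f≡ u) (f≡ v) ⟩
    modelArc (K-colour p k ∘ (π ⟨$⟩ʳ_)) u v               ≡⟨ modelArc-permute π (K-colour p k) u v ⟩
    modelArc (K-colour p k) (π ⟨$⟩ʳ u) (π ⟨$⟩ʳ v)         ≡⟨ sym (arc-K _ k p (π ⟨$⟩ʳ u) (π ⟨$⟩ʳ v)) ⟩
    arc (K _ k p) (π ⟨$⟩ʳ u) (π ⟨$⟩ʳ v)                   ∎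
    where open ≡.≡-Reasoning

  -- Vertex cuts

  record Cut {n} (G : Digraph n) (k : ℕ) : Set where
    field
      colour : Fin n → Colour
      P-size : 1 ≤ count P colour
      S-size : count S colour ≡ k
      R-size : 1 ≤ count R colour
      no-arc : ∀ u v → colour u ≡ R → colour v ≡ P → ¬ Arc G u v

  count-S-subset : ∀ {n} (X : Subset n) (f : Fin n → Colour) →
                   (∀ v → v ∈ X → f v ≡ S) → (∀ v → v ∉ X → f v ≢ S) → count S f ≡ ∣ X ∣
  count-S-subset []          f inside outside = refl
  count-S-subset (true  ∷ X) f inside outside rewrite inside zero here =
    cong suc (count-S-subset X (f ∘ suc) (λ v v∈X → inside (suc v) (there v∈X)) (λ v v∉X → outside (suc v) λ { (there v∈X) → v∉X v∈X }))
  count-S-subset (false ∷ X) f inside outside rewrite tally-≢ (outside zero (λ ()) ∘ sym) =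
    count-S-subset X (f ∘ suc) (λ v v∈X → inside (suc v) (there v∈X)) (λ v v∉X → outside (suc v) λ { (there v∈X) → v∉X v∈X })

  module Reachability {n} (G : Digraph n) (X : Subset n) where

    -- `U` plays the set of vertices reached from `source`; by `closed`, its arcs lead out of it
    -- only into `X`.
    record Separation : Set where
      field
        U        : Subset n
        source   : Fin n
        target   : Fin n
        source∈U : source ∈ U
        source∉X : source ∉ X
        target∉U : target ∉ U
        target∉X : target ∉ X
        closed   : ∀ u v → u ∈ U → v ∉ X → v ∉ U → ¬ Arc G u v

    -- If an arc leaves `U` outside `X`, its head joins `U`; otherwise `U` is closed, and any vertex
    -- still missing gives a separation. Strict growth inside a finite set bounds the search.
    explore : ∀ s → s ∉ X → (U : Subset n) → Acc _⊃_ U → s ∈ U →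
              (∀ u → u ∈ U → u ∉ X × Star (ArcOff G X) s u) →
              Separation ⊎ (∀ v → v ∉ X → Star (ArcOff G X) s v)
    explore s s∉X U (acc larger) s∈U reached
      with Finₚ.any? (λ v → ¬? (v ∈? X) ×-dec (¬? (v ∈? U) ×-dec Finₚ.any? (λ u → (u ∈? U) ×-dec T? (arc G u v))))
    ... | yes (v , v∉X , v∉U , u , u∈U , u→v) =
      explore s s∉X (U ∪ ⁅ v ⁆) (larger (p⊆p∪q ⁅ v ⁆ , v , q⊆p∪q U ⁅ v ⁆ (x∈⁅x⁆ v) , v∉U)) (p⊆p∪q ⁅ v ⁆ s∈U) reached′
      where
      reached′ : ∀ w → w ∈ U ∪ ⁅ v ⁆ → w ∉ X × Star (ArcOff G X) s w
      reached′ w w∈ with x∈p∪q⁻ U ⁅ v ⁆ w∈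
      ... | inj₁ w∈U = reached w w∈U
      ... | inj₂ w∈v with x∈⁅y⁆⇒x≡y v w∈v
      ...   | refl = v∉X , (proj₂ (reached u u∈U) ◅◅ ((proj₁ (reached u u∈U) , v∉X , u→v) ◅ ε))
    ... | no closed with Finₚ.any? (λ v → ¬? (v ∈? X) ×-dec ¬? (v ∈? U))
    ...   | yes (t , t∉X , t∉U) = inj₁ record
      { U        = U
      ; source   = s
      ; target   = t
      ; source∈U = s∈U
      ; source∉X = s∉X
      ; target∉U = t∉U
      ; target∉X = t∉X
      ; closed   = λ u v u∈U v∉X v∉U u→v → closed (v , v∉X , v∉U , u , u∈U , u→v)
      }
    ...   | no none = inj₂ λ v v∉X → proj₂ (reached v (inside v v∉X))
      where
      inside : ∀ v → v ∉ X → v ∈ U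
      inside v v∉X with v ∈? U
      ... | yes v∈U = v∈U
      ... | no  v∉U = ⊥-elim (none (v , v∉X , v∉U))

    separated-or-reaching : ∀ s → s ∉ X → Separation ⊎ (∀ v → v ∉ X → Star (ArcOff G X) s v)
    separated-or-reaching s s∉X = explore s s∉X ⁅ s ⁆ (⊃-wellFounded ⁅ s ⁆) (x∈⁅x⁆ s) reached
      where
      reached : ∀ u → u ∈ ⁅ s ⁆ → u ∉ X × Star (ArcOff G X) s u
      reached u u∈s with x∈⁅y⁆⇒x≡y s u∈s
      ... | refl = s∉X , ε

    some-or-all : ∀ {m} {A : Set} {B : Fin m → Set} → (∀ i → A ⊎ B i) → A ⊎ (∀ i → B i)
    some-or-all {zero}  h = inj₂ λ ()
    some-or-all {suc m} h with h zero | some-or-all (h ∘ suc)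
    ... | inj₁ a  | _       = inj₁ a
    ... | inj₂ _  | inj₁ a  = inj₁ a
    ... | inj₂ b₀ | inj₂ b  = inj₂ λ { zero → b₀ ; (suc i) → b i }

    -- The negated hypothesis carries no witness. The search from every vertex outside `X` finds
    -- one, because it would otherwise supply all the walks denied by the hypothesis.
    separation : ¬ StronglyConnectedOff G X → Separation
    separation not-connected with some-or-all from-each
      where
      from-each : ∀ s → Separation ⊎ (s ∉ X → ∀ v → v ∉ X → Star (ArcOff G X) s v)
      from-each s with s ∈? X
      ... | yes s∈X = inj₂ λ s∉X → ⊥-elim (s∉X s∈X)
      ... | no  s∉X = [ inj₁ , (λ reach → inj₂ λ _ → reach) ]′ (separated-or-reaching s s∉X)
    ... | inj₁ sep   = sep
    ... | inj₂ reach = ⊥-elim (not-connected λ u v u∉X v∉X → reach u u∉X v v∉X)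

    -- Reached vertices become R and unreached ones P, so that `closed` is the absence of arcs from
    -- R to P; `source` and `target` make both classes inhabited.
    separation⇒cut : Separation → Cut G ∣ X ∣
    separation⇒cut sep = record
      { colour = colour
      ; P-size = count-present P colour target (outside target∉X target∉U)
      ; S-size = count-S-subset X colour (λ v → in-X) not-S
      ; R-size = count-present R colour source (in-U source∉X source∈U)
      ; no-arc = λ u v fu≡R fv≡P → closed u v (R⇒∈U u fu≡R) (proj₁ (P⇒∉ v fv≡P)) (proj₂ (P⇒∉ v fv≡P))
      }
      where
      open Separation sep
      colour : Fin n → Colour
      colour v = if does (v ∈? X) then S else if does (v ∈? U) then R else P
      in-X : ∀ {v} → v ∈ X → colour v ≡ S
      in-X {v} v∈X rewrite dec-true (v ∈? X) v∈X = refl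
      in-U : ∀ {v} → v ∉ X → v ∈ U → colour v ≡ R
      in-U {v} v∉X v∈U rewrite dec-false (v ∈? X) v∉X | dec-true (v ∈? U) v∈U = refl
      outside : ∀ {v} → v ∉ X → v ∉ U → colour v ≡ P
      outside {v} v∉X v∉U rewrite dec-false (v ∈? X) v∉X | dec-false (v ∈? U) v∉U = refl
      not-S : ∀ v → v ∉ X → colour v ≢ S
      not-S v v∉X with v ∈? X | v ∈? U
      ... | yes v∈X | _     = ⊥-elim (v∉X v∈X)
      ... | no _    | yes _ = λ ()
      ... | no _    | no _  = λ ()
      R⇒∈U : ∀ v → colour v ≡ R → v ∈ U
      R⇒∈U v with v ∈? X | v ∈? U
      ... | yes _ | _       = λ ()
      ... | no _  | yes v∈U = λ _ → v∈U
      ... | no _  | no _    = λ ()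
      P⇒∉ : ∀ v → colour v ≡ P → v ∉ X × v ∉ U
      P⇒∉ v with v ∈? X | v ∈? U
      ... | yes _  | _      = λ ()
      ... | no _   | yes _  = λ ()
      ... | no v∉X | no v∉U = λ _ → v∉X , v∉U

  -- The complete digraph has connectivity `n ∸ 1`, which `k + 2 ≤ n` excludes; in the other case a
  -- minimum cut is given.
  connectivity⇒cut : ∀ {n k} {G : Digraph n} → k + 2 ≤ n → G ∈Ω[ k ] → Cut G k
  connectivity⇒cut {n} {k} {G} k+2≤n G∈Ω with _∈Ω[_].vertexConnectivity G∈Ω
  ... | inj₁ (_ , refl) = contradiction (ℕₚ.≤-trans (ℕₚ.≤-reflexive (ℕₚ.+-comm 2 _)) k+2≤n) (pred-small n)
    where
    pred-small : ∀ n → ¬ (2 + (n ∸ 1) ≤ n)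
    pred-small (suc n) (s≤s n<n) = ℕₚ.<-irrefl refl n<n
  ... | inj₂ (_ , (X , refl , not-connected) , _) = separation⇒cut (separation not-connected)
    where open Reachability G X

  -- Weighted forms: e = 0 for arcs, e = 2 for distances

  blockWeight : ℕ → Colour → Colour → ℕ
  blockWeight e R P = e
  blockWeight e _ _ = 1

  weight : ∀ {n} → ℕ → (Fin n → Colour) → Fin n → Fin n → ℕ
  weight e f u v = if does (u ≟ v) then 0 else blockWeight e (f u) (f v)

  arcCount : ∀ {n} → Digraph n → Fin n → Fin n → ℕ
  arcCount G u v = if arc G u v then 1 else 0

  blockWeight-0 : ∀ c d → (if not (isR c ∧ isP d) then 1 else 0) ≡ blockWeight 0 c d
  blockWeight-0 P d = refl
  blockWeight-0 S d = refl
  blockWeight-0 R P = refl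
  blockWeight-0 R S = refl
  blockWeight-0 R R = refl

  modelArc-weight : ∀ {n} (f : Fin n → Colour) u v → (if modelArc f u v then 1 else 0) ≡ weight 0 f u v
  modelArc-weight f u v with does (u ≟ v)
  ... | true  = refl
  ... | false = blockWeight-0 (f u) (f v)

  model⇒arcCount : ∀ {n} {G : Digraph n} {f} → IsModel G f → ∀ u v → arcCount G u v ≡ weight 0 f u v
  model⇒arcCount {f = f} model u v = trans (cong (λ b → if b then 1 else 0) (model u v)) (modelArc-weight f u v)

  indicator-injective : ∀ {b c} → (if b then 1 else 0) ≡ (if c then 1 else 0) → b ≡ c
  indicator-injective {true}  {true}  _ = refl
  indicator-injective {false} {false} _ = refl

  arcCount⇒model : ∀ {n} {G : Digraph n} {f} → (∀ u v → arcCount G u v ≡ weight 0 f u v) → IsModel G f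
  arcCount⇒model {f = f} same u v = indicator-injective (trans (same u v) (sym (modelArc-weight f u v)))

  T-elim : ∀ {b} → T b → b ≡ true
  T-elim {true} _ = refl

  module _ {n} {G : Digraph n} where

    arc-irrefl : ∀ {u v} → Arc G u v → u ≢ v
    arc-irrefl {u} u→u refl = subst T (loopless G u) u→u

    -- Off the diagonal the model vanishes only from R to P, where the cut forbids arcs.
    arcCount-≤ : ∀ {k} (cut : Cut G k) → ∀ u v → arcCount G u v ≤ weight 0 (Cut.colour cut) u v
    arcCount-≤ cut u v with arc G u v in uv
    ... | false = z≤n
    ... | true rewrite dec-false (u ≟ v) (arc-irrefl (subst T (sym uv) tt)) =
      bound (Cut.colour cut u) (Cut.colour cut v) λ { (cu , cv) → Cut.no-arc cut u v cu cv (subst T (sym uv) tt) }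
      where
      bound : ∀ c d → ¬ (c ≡ R × d ≡ P) → 1 ≤ blockWeight 0 c d
      bound P d _ = s≤s z≤n
      bound S d _ = s≤s z≤n
      bound R P c = ⊥-elim (c (refl , refl))
      bound R S _ = s≤s z≤n
      bound R R _ = s≤s z≤n

    arcCount-pos : ∀ {u v} → Arc G u v → 1 ≤ arcCount G u v
    arcCount-pos u→v rewrite T-elim u→v = s≤s z≤n

    module Distances {d : Fin n → Fin n → ℕ} (distance : IsDistance G d) where

      trivial-path : ∀ u → Path G u u 0
      trivial-path u = record
        { vertex = λ _ → u ; distinct = λ { {zero} {zero} _ → refl } ; start = refl ; end = refl ; arcs = λ () }

      distance-refl : ∀ u → d u u ≡ 0
      distance-refl u = ℕₚ.n≤0⇒n≡0 (proj₂ (distance u u) 0 (trivial-path u))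

      path-0 : ∀ {u v} → Path G u v 0 → u ≡ v
      path-0 path = trans (sym (Path.start path)) (Path.end path)

      path-1 : ∀ {u v} → Path G u v 1 → Arc G u v
      path-1 path = subst (λ a → Arc G a _) (Path.start path) (subst (λ b → Arc G _ b) (Path.end path) (Path.arcs path zero))

      distance-pos : ∀ {u v} → u ≢ v → 1 ≤ d u v
      distance-pos {u} {v} u≢v with d u v | proj₁ (distance u v)
      ... | zero  | path = ⊥-elim (u≢v (path-0 path))
      ... | suc _ | _    = s≤s z≤n

      distance-1⇒arc : ∀ {u v} → d u v ≡ 1 → Arc G u v
      distance-1⇒arc {u} {v} d≡1 = path-1 (subst (Path G u v) d≡1 (proj₁ (distance u v)))

      arc⇒distance-1 : ∀ {u v} → Arc G u v → d u v ≡ 1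
      arc⇒distance-1 {u} {v} u→v = ℕₚ.≤-antisym (proj₂ (distance u v) 1 path) (distance-pos (arc-irrefl u→v))
        where
        vertex : Vector (Fin n) 2
        vertex zero       = u
        vertex (suc zero) = v
        path : Path G u v 1
        path = record
          { vertex   = vertex
          ; distinct = λ { {zero} {zero} _ → refl ; {zero} {suc zero} e → ⊥-elim (arc-irrefl u→v e)
                         ; {suc zero} {zero} e → ⊥-elim (arc-irrefl u→v (sym e)) ; {suc zero} {suc zero} _ → refl }
          ; start    = refl
          ; end      = refl
          ; arcs     = λ { zero → u→v }
          }

      distance-≤2 : ∀ {u w v} → u ≢ v → Arc G u w → Arc G w v → d u v ≤ 2
      distance-≤2 {u} {w} {v} u≢v u→w w→v = proj₂ (distance u v) 2 path
        where
        vertex : Vector (Fin n) 3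
        vertex zero             = u
        vertex (suc zero)       = w
        vertex (suc (suc zero)) = v
        distinct : ∀ {i j} → vertex i ≡ vertex j → i ≡ j
        distinct {zero}           {zero}           _ = refl
        distinct {zero}           {suc zero}       e = ⊥-elim (arc-irrefl u→w e)
        distinct {zero}           {suc (suc zero)} e = ⊥-elim (u≢v e)
        distinct {suc zero}       {zero}           e = ⊥-elim (arc-irrefl u→w (sym e))
        distinct {suc zero}       {suc zero}       _ = refl
        distinct {suc zero}       {suc (suc zero)} e = ⊥-elim (arc-irrefl w→v e)
        distinct {suc (suc zero)} {zero}           e = ⊥-elim (u≢v (sym e))
        distinct {suc (suc zero)} {suc zero}       e = ⊥-elim (arc-irrefl w→v (sym e))
        distinct {suc (suc zero)} {suc (suc zero)} _ = refl
        path : Path G u v 2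
        path = record
          { vertex = vertex ; distinct = distinct ; start = refl ; end = refl
          ; arcs = λ { zero → u→w ; (suc zero) → w→v } }

      distance-no-arc : ∀ {u v} → u ≢ v → ¬ Arc G u v → 2 ≤ d u v
      distance-no-arc u≢v no-arc = ℕₚ.≤∧≢⇒< (distance-pos u≢v) (no-arc ∘ distance-1⇒arc ∘ sym)

      -- Distinct vertices are at distance at least 1, and from R to P at least 2 for want of an
      -- arc.
      weight-≤-distance : ∀ {k} (cut : Cut G k) → ∀ u v → weight 2 (Cut.colour cut) u v ≤ d u v
      weight-≤-distance cut u v with u ≟ v
      ... | yes _   = z≤n
      ... | no  u≢v with Cut.colour cut u in cu | Cut.colour cut v in cv
      ...   | P | _ = distance-pos u≢v
      ...   | S | _ = distance-pos u≢v
      ...   | R | P = distance-no-arc u≢v (Cut.no-arc cut u v cu cv)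
      ...   | R | S = distance-pos u≢v
      ...   | R | R = distance-pos u≢v

      -- Distance 1 means adjacency, so the entries 2 mark exactly the missing arcs.
      distance⇒model : ∀ {f} → (∀ u v → d u v ≡ weight 2 f u v) → IsModel G f
      distance⇒model {f} same u v with u ≟ v | same u v
      ... | yes refl | _ = loopless G u
      ... | no u≢v | d≡ with f u | f v
      ...   | P | _ = T-elim (distance-1⇒arc d≡)
      ...   | S | _ = T-elim (distance-1⇒arc d≡)
      ...   | R | S = T-elim (distance-1⇒arc d≡)
      ...   | R | R = T-elim (distance-1⇒arc d≡)
      ...   | R | P with arc G u v in uv
      ...     | false = refl
      ...     | true  = contradiction (trans (sym d≡) (arc⇒distance-1 (subst T (sym uv) tt))) λ ()

      -- Any vertex of S is an intermediate stop from R to P, which brings the distance there down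
      -- to 2.
      model⇒distance : ∀ {f} → 1 ≤ count S f → IsModel G f → ∀ u v → d u v ≡ weight 2 f u v
      model⇒distance {f} 1≤S model u v with u ≟ v | model u v
      ... | yes refl | _ = distance-refl u
      ... | no u≢v | uv with f u in fu | f v in fv
      ...   | P | _ = arc⇒distance-1 (subst T (sym uv) tt)
      ...   | S | _ = arc⇒distance-1 (subst T (sym uv) tt)
      ...   | R | S = arc⇒distance-1 (subst T (sym uv) tt)
      ...   | R | R = arc⇒distance-1 (subst T (sym uv) tt)
      ...   | R | P with count-pos⇒present S f 1≤S
      ...     | w , fw = ℕₚ.≤-antisym (distance-≤2 u≢v u→w w→v) (distance-no-arc u≢v (subst T uv))
        where
        u→w : Arc G u w
        u→w rewrite model u w | fu | fw | dec-false (u ≟ w) (λ { refl → contradiction (trans (sym fu) fw) λ () }) = tt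
        w→v : Arc G w v
        w→v rewrite model w v | fv | fw | dec-false (w ≟ v) (λ { refl → contradiction (trans (sym fv) fw) λ () }) = tt

  -- Equality is first characterised by a condition `E` on the class sizes, the form in which a
  -- vanishing excess delivers it; the isomorphisms with `K n k p` are derived from this separately.
  ExtremalModel : ∀ {n} → Digraph n → ℕ → (ℕ → ℕ → Set) → Set
  ExtremalModel {n} G k E = ∃[ p ] ∃[ r ] ∃[ f ]
    (n ≡ p + (k + r) × 1 ≤ p × 1 ≤ r × HasSizes p k r f × IsModel G f × E p r)

  module _ {n k} (k+2≤n : k + 2 ≤ n) (G : Digraph n) where

    complement : ℕ
    complement = n ∸ k ∸ 1

    n-split : n ≡ complement + (k + 1)
    n-split = sym (trans (cong (_+ (k + 1)) (ℕₚ.∸-+-assoc n k 1))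
      (ℕₚ.m∸n+n≡m (ℕₚ.≤-trans (ℕₚ.+-monoʳ-≤ k (s≤s z≤n)) k+2≤n)))

    n-split′ : n ≡ 1 + (k + complement)
    n-split′ = trans n-split (trans (cong (complement +_) (ℕₚ.+-comm k 1))
      (trans (ℕₚ.+-suc complement k) (cong suc (ℕₚ.+-comm complement k))))

    complement-pos : 1 ≤ complement
    complement-pos = ℕₚ.+-cancelʳ-≤ (k + 1) 1 complement
      (ℕₚ.≤-trans (ℕₚ.≤-reflexive (trans (cong suc (ℕₚ.+-comm k 1)) (ℕₚ.+-comm 2 k))) (ℕₚ.≤-trans k+2≤n (ℕₚ.≤-reflexive n-split)))

    extremal-P : ExtremalModel G k (λ p r → p ≡ 1) ⇔ (G ≅ K n k 1)
    extremal-P = mk⇔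
      (λ { (p , r , f , _ , _ , _ , sizes , model , refl) → model⇒≅K G 1 k r f sizes model })
      (λ iso → let (f , sizes , model) = ≅K⇒model G 1 k complement n-split′ iso
               in 1 , complement , f , n-split′ , s≤s z≤n , complement-pos , sizes , model , refl)

    extremal-R : ExtremalModel G k (λ p r → r ≡ 1) ⇔ (G ≅ K n k (n ∸ k ∸ 1))
    extremal-R = mk⇔
      (λ { (p , r , f , n≡ , _ , _ , sizes , model , refl) →
           -- One vertex in R leaves `n ∸ k ∸ 1` vertices for P.
           subst (λ p → G ≅ K n k p) (ℕₚ.+-cancelʳ-≡ (k + 1) p complement (trans (sym n≡) n-split))
             (model⇒≅K G p k 1 f sizes model) })
      (λ iso → let (f , sizes , model) = ≅K⇒model G complement k 1 n-split iso
               in complement , 1 , f , n-split , complement-pos , s≤s z≤n , sizes , model , refl)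

    extremal-either : ExtremalModel G k (λ p r → p ≡ 1 ⊎ r ≡ 1) ⇔ ((G ≅ K n k 1) ⊎ (G ≅ K n k (n ∸ k ∸ 1)))
    extremal-either = mk⇔
      (λ { (p , r , f , n≡ , 1≤p , 1≤r , sizes , model , inj₁ p≡1) →
             inj₁ (Equivalence.to extremal-P (p , r , f , n≡ , 1≤p , 1≤r , sizes , model , p≡1))
         ; (p , r , f , n≡ , 1≤p , 1≤r , sizes , model , inj₂ r≡1) →
             inj₂ (Equivalence.to extremal-R (p , r , f , n≡ , 1≤p , 1≤r , sizes , model , r≡1)) })
      [ (λ iso → weaken inj₁ (Equivalence.from extremal-P iso)) , (λ iso → weaken inj₂ (Equivalence.from extremal-R iso)) ]′
      where
      weaken : ∀ {E E′ : ℕ → ℕ → Set} → (∀ {p r} → E p r → E′ p r) → ExtremalModel G k E → ExtremalModel G k E′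
      weaken h (p , r , f , n≡ , 1≤p , 1≤r , sizes , model , ext) = p , r , f , n≡ , 1≤p , 1≤r , sizes , model , h ext

open import Data.Integer using (ℤ; +_; -[1+_]; _⊖_)

-- Ring identities and inequalities in the ordered field

module OrderedField (ℝ : CompleteOrderedField) where
  open CompleteOrderedField ℝ public hiding (zero)
  open RingProperties ring using (-‿distribˡ-*; -‿distribʳ-*; -‿involutive; -0#≈0#; -‿+-comm)
  open MultProperties semiring using (×-homo-+; ×1-homo-*)
  open import Relation.Binary.Reasoning.Setoid setoid

  -- The ring solver is run with integer coefficients, so that con (+ n) means ι n.

  ⟦_⟧ᶻ : ℤ → Carrier
  ⟦ + n ⟧ᶻ      = ι n
  ⟦ -[1+ n ] ⟧ᶻ = - ι (suc n)

  private
    cancel-1 : ∀ x y → (1# + x) + - (1# + y) ≈ x + - y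
    cancel-1 x y = begin
      (1# + x) + - (1# + y)      ≈⟨ +-congˡ (sym (-‿+-comm 1# y)) ⟩
      (1# + x) + (- 1# + - y)    ≈⟨ +-assoc (1# + x) (- 1#) (- y) ⟨
      ((1# + x) + - 1#) + - y    ≈⟨ +-congʳ (+-congʳ (+-comm 1# x)) ⟩
      ((x + 1#) + - 1#) + - y    ≈⟨ +-congʳ (+-assoc x 1# (- 1#)) ⟩
      (x + (1# + - 1#)) + - y    ≈⟨ +-congʳ (+-congˡ (-‿inverseʳ 1#)) ⟩
      (x + 0#) + - y             ≈⟨ +-congʳ (+-identityʳ x) ⟩
      x + - y                    ∎

    ⊖-homo : ∀ m n → ⟦ m ⊖ n ⟧ᶻ ≈ ι m + - ι n
    ⊖-homo m       zero    = sym (trans (+-congˡ -0#≈0#) (+-identityʳ (ι m)))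
    ⊖-homo zero    (suc n) = sym (+-identityˡ (- ι (suc n)))
    ⊖-homo (suc m) (suc n) = begin
      ⟦ suc m ⊖ suc n ⟧ᶻ        ≡⟨ ≡.cong ⟦_⟧ᶻ (ℤₚ.[1+m]⊖[1+n]≡m⊖n m n) ⟩
      ⟦ m ⊖ n ⟧ᶻ                ≈⟨ ⊖-homo m n ⟩
      ι m + - ι n               ≈⟨ cancel-1 (ι m) (ι n) ⟨
      ι (suc m) + - ι (suc n)   ∎

    neg-homo : ∀ i → ⟦ ℤ.- i ⟧ᶻ ≈ - ⟦ i ⟧ᶻ
    neg-homo (+ zero)  = sym -0#≈0#
    neg-homo (+ suc n) = refl
    neg-homo -[1+ n ]  = sym (-‿involutive (ι (suc n)))

    add-homo : ∀ i j → ⟦ i ℤ.+ j ⟧ᶻ ≈ ⟦ i ⟧ᶻ + ⟦ j ⟧ᶻ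
    add-homo (+ m)    (+ n)    = ×-homo-+ 1# m n
    add-homo (+ m)    -[1+ n ] = ⊖-homo m (suc n)
    add-homo -[1+ m ] (+ n)    = trans (⊖-homo n (suc m)) (+-comm (ι n) (- ι (suc m)))
    add-homo -[1+ m ] -[1+ n ] = begin
      - ι (suc (suc (m Nat.+ n)))      ≡⟨ ≡.cong (λ k → - ι (suc k)) (ℕₚ.+-suc m n) ⟨
      - ι (suc m Nat.+ suc n)          ≈⟨ -‿cong (×-homo-+ 1# (suc m) (suc n)) ⟩
      - (ι (suc m) + ι (suc n))      ≈⟨ -‿+-comm (ι (suc m)) (ι (suc n)) ⟨
      - ι (suc m) + - ι (suc n)      ∎

    mul-homo-pos : ∀ m j → ⟦ + m ℤ.* j ⟧ᶻ ≈ ι m * ⟦ j ⟧ᶻ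
    mul-homo-pos m (+ n)    = trans (reflexive (≡.cong ⟦_⟧ᶻ (≡.sym (ℤₚ.pos-* m n)))) (×1-homo-* m n)
    mul-homo-pos m -[1+ n ] = begin
      ⟦ + m ℤ.* -[1+ n ] ⟧ᶻ        ≡⟨ ≡.cong ⟦_⟧ᶻ (≡.sym (ℤₚ.neg-distribʳ-* (+ m) (+ suc n))) ⟩
      ⟦ ℤ.- (+ m ℤ.* + suc n) ⟧ᶻ   ≈⟨ neg-homo (+ m ℤ.* + suc n) ⟩
      - ⟦ + m ℤ.* + suc n ⟧ᶻ       ≈⟨ -‿cong (mul-homo-pos m (+ suc n)) ⟩
      - (ι m * ι (suc n))          ≈⟨ -‿distribʳ-* (ι m) (ι (suc n)) ⟩
      ι m * - ι (suc n)            ∎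

    mul-homo : ∀ i j → ⟦ i ℤ.* j ⟧ᶻ ≈ ⟦ i ⟧ᶻ * ⟦ j ⟧ᶻ
    mul-homo (+ m)    j = mul-homo-pos m j
    mul-homo -[1+ m ] j = begin
      ⟦ -[1+ m ] ℤ.* j ⟧ᶻ          ≡⟨ ≡.cong ⟦_⟧ᶻ (≡.sym (ℤₚ.neg-distribˡ-* (+ suc m) j)) ⟩
      ⟦ ℤ.- (+ suc m ℤ.* j) ⟧ᶻ     ≈⟨ neg-homo (+ suc m ℤ.* j) ⟩
      - ⟦ + suc m ℤ.* j ⟧ᶻ         ≈⟨ -‿cong (mul-homo-pos (suc m) j) ⟩
      - (ι (suc m) * ⟦ j ⟧ᶻ)       ≈⟨ -‿distribˡ-* (ι (suc m)) ⟦ j ⟧ᶻ ⟩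
      - ι (suc m) * ⟦ j ⟧ᶻ         ∎

  integers : ℤ.+-*-rawRing -Raw-AlmostCommutative⟶ fromCommutativeRing commutativeRing
  integers = record
    { ⟦_⟧    = ⟦_⟧ᶻ
    ; +-homo = add-homo
    ; *-homo = mul-homo
    ; -‿homo = neg-homo
    ; 0-homo = refl
    ; 1-homo = +-identityʳ 1#
    }

  ⟦⟧ᶻ-weaklyDecidable : ∀ i j → Maybe (⟦ i ⟧ᶻ ≈ ⟦ j ⟧ᶻ)
  ⟦⟧ᶻ-weaklyDecidable i j with i ℤ.≟ j
  ... | yes i≡j = just (reflexive (≡.cong ⟦_⟧ᶻ i≡j))
  ... | no  _   = nothing

  open RingSolver ℤ.+-*-rawRing (fromCommutativeRing commutativeRing) integers ⟦⟧ᶻ-weaklyDecidable public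
    using (solve; _:=_; con; _:+_; _:*_; _:-_; :-_; _:^_)

  open IsDecTotalOrder isDecTotalOrder public
    using (_≤?_; total; antisym)
    renaming (refl to ≤-refl; reflexive to ≤-reflexive; trans to ≤-trans; _≟_ to _≈?_)

  infix 4 _<_

  -- In a decidable total order the negated reverse inequality serves as the strict order; strict
  -- claims are then proved by refutation.
  _<_ : Carrier → Carrier → Set
  x < y = ¬ y ≤ x

  ≤-respʳ : ∀ {x y z} → y ≈ z → x ≤ y → x ≤ z
  ≤-respʳ y≈z x≤y = ≤-trans x≤y (≤-reflexive y≈z)

  ≤-respˡ : ∀ {x y z} → x ≈ y → x ≤ z → y ≤ z
  ≤-respˡ x≈y x≤z = ≤-trans (≤-reflexive (sym x≈y)) x≤z

  <⇒≤ : ∀ {x y} → x < y → x ≤ y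
  <⇒≤ {x} {y} x<y = [ (λ x≤y → x≤y) , (λ y≤x → ⊥-elim (x<y y≤x)) ]′ (total x y)

  ≤-<-trans : ∀ {x y z} → x ≤ y → y < z → x < z
  ≤-<-trans x≤y y<z z≤x = y<z (≤-trans z≤x x≤y)

  <-≤-trans : ∀ {x y z} → x < y → y ≤ z → x < z
  <-≤-trans x<y y≤z z≤x = x<y (≤-trans y≤z z≤x)

  <-respʳ : ∀ {x y z} → y ≈ z → x < y → x < z
  <-respʳ y≈z x<y = <-≤-trans x<y (≤-reflexive y≈z)

  <-respˡ : ∀ {x y z} → x ≈ y → x < z → y < z
  <-respˡ x≈y x<z = ≤-<-trans (≤-reflexive (sym x≈y)) x<z

  <⇒≉ : ∀ {x y} → x < y → ¬ x ≈ y
  <⇒≉ x<y x≈y = x<y (≤-reflexive (sym x≈y))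

  ≤∧≉⇒< : ∀ {x y} → x ≤ y → ¬ x ≈ y → x < y
  ≤∧≉⇒< x≤y x≉y y≤x = x≉y (antisym x≤y y≤x)

  ≮⇒≥ : ∀ {x y} → ¬ x < y → y ≤ x
  ≮⇒≥ {x} {y} x≮y with y ≤? x
  ... | yes y≤x = y≤x
  ... | no  x<y = ⊥-elim (x≮y x<y)

  +-mono-≤ : ∀ {x y u v} → x ≤ y → u ≤ v → x + u ≤ y + v
  +-mono-≤ {x} {y} {u} {v} x≤y u≤v =
    ≤-trans (+-monoˡ-≤ x y u x≤y)
      (≤-respˡ (+-comm u y) (≤-respʳ (+-comm v y) (+-monoˡ-≤ u v y u≤v)))

  sub-nonneg : ∀ {x y} → x ≤ y → 0# ≤ y - x
  sub-nonneg {x} {y} x≤y = ≤-respˡ (-‿inverseʳ x) (+-monoˡ-≤ x y (- x) x≤y)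

  nonneg-sub : ∀ {x y} → 0# ≤ y - x → x ≤ y
  nonneg-sub {x} {y} 0≤y-x =
    ≤-respˡ (+-identityˡ x)
      (≤-respʳ (solve 2 (λ x y → y :- x :+ x := y) refl x y) (+-monoˡ-≤ 0# (y - x) x 0≤y-x))

  sub-pos : ∀ {x y} → x < y → 0# < y - x
  sub-pos {x} {y} x<y y-x≤0 =
    x<y (≤-respˡ (solve 2 (λ x y → y :- x :+ x := y) refl x y)
      (≤-respʳ (+-identityˡ x) (+-monoˡ-≤ (y - x) 0# x y-x≤0)))

  pos-sub : ∀ {x y} → 0# < y - x → x < y
  pos-sub {x} {y} 0<y-x y≤x =
    0<y-x (≤-respʳ (-‿inverseʳ x) (+-monoˡ-≤ y x (- x) y≤x))

  +-mono-<-≤ : ∀ {x y u v} → x < y → u ≤ v → x + u < y + v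
  +-mono-<-≤ {x} {y} {u} {v} x<y u≤v yv≤xu =
    x<y (nonneg-sub (≤-respʳ (solve 4 (λ x y u v → (x :+ u :- (y :+ v)) :+ (v :- u) := x :- y) refl x y u v)
      (≤-respˡ (+-identityˡ 0#) (+-mono-≤ (sub-nonneg yv≤xu) (sub-nonneg u≤v)))))

  +-mono-≤-< : ∀ {x y u v} → x ≤ y → u < v → x + u < y + v
  +-mono-≤-< x≤y u<v =
    <-respˡ (+-comm _ _) (<-respʳ (+-comm _ _) (+-mono-<-≤ u<v x≤y))

  +-nonneg : ∀ {x y} → 0# ≤ x → 0# ≤ y → 0# ≤ x + y
  +-nonneg 0≤x 0≤y = ≤-respˡ (+-identityˡ 0#) (+-mono-≤ 0≤x 0≤y)

  +-pos-nonneg : ∀ {x y} → 0# < x → 0# ≤ y → 0# < x + y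
  +-pos-nonneg 0<x 0≤y = <-respˡ (+-identityˡ 0#) (+-mono-<-≤ 0<x 0≤y)

  +-nonneg-pos : ∀ {x y} → 0# ≤ x → 0# < y → 0# < x + y
  +-nonneg-pos 0≤x 0<y = <-respˡ (+-identityˡ 0#) (+-mono-≤-< 0≤x 0<y)

  square-nonneg : ∀ x → 0# ≤ x * x
  square-nonneg x with total 0# x
  ... | inj₁ 0≤x = *-nonneg x x 0≤x 0≤x
  ... | inj₂ x≤0 = ≤-respʳ (solve 1 (λ x → (con (+ 0) :- x) :* (con (+ 0) :- x) := x :* x) refl x)
                     (*-nonneg (0# - x) (0# - x) (sub-nonneg x≤0) (sub-nonneg x≤0))

  0<1 : 0# < 1#
  0<1 = ≤∧≉⇒< (≤-respʳ (*-identityˡ 1#) (square-nonneg 1#)) 0≉1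

  *-cancelˡ-0 : ∀ {x y} → ¬ x ≈ 0# → x * y ≈ 0# → y ≈ 0#
  *-cancelˡ-0 {x} {y} x≉0 xy≈0 = begin
    y                   ≈⟨ *-identityˡ y ⟨
    1# * y              ≈⟨ *-congʳ (⁻¹-inverse x x≉0) ⟨
    (x * x ⁻¹) * y      ≈⟨ solve 3 (λ x i y → x :* i :* y := i :* (x :* y)) refl x (x ⁻¹) y ⟩
    x ⁻¹ * (x * y)      ≈⟨ *-congˡ xy≈0 ⟩
    x ⁻¹ * 0#           ≈⟨ zeroʳ (x ⁻¹) ⟩
    0#                  ∎

  pos⇒≉0 : ∀ {x} → 0# < x → ¬ x ≈ 0#
  pos⇒≉0 0<x x≈0 = <⇒≉ 0<x (sym x≈0)

  *-pos : ∀ {x y} → 0# < x → 0# < y → 0# < x * y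
  *-pos {x} {y} 0<x 0<y xy≤0 =
    pos⇒≉0 0<y (*-cancelˡ-0 (pos⇒≉0 0<x) (antisym xy≤0 (*-nonneg x y (<⇒≤ 0<x) (<⇒≤ 0<y))))

  *-monoʳ-≤ : ∀ {x y z} → 0# ≤ z → x ≤ y → z * x ≤ z * y
  *-monoʳ-≤ {x} {y} {z} 0≤z x≤y =
    nonneg-sub (≤-respʳ (solve 3 (λ x y z → z :* (y :- x) := z :* y :- z :* x) refl x y z)
      (*-nonneg z (y - x) 0≤z (sub-nonneg x≤y)))

  *-monoʳ-< : ∀ {x y z} → 0# < z → x < y → z * x < z * y
  *-monoʳ-< {x} {y} {z} 0<z x<y =
    pos-sub (<-respʳ (solve 3 (λ x y z → z :* (y :- x) := z :* y :- z :* x) refl x y z)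
      (*-pos 0<z (sub-pos x<y)))

  *-monoˡ-≤ : ∀ {x y z} → 0# ≤ z → x ≤ y → x * z ≤ y * z
  *-monoˡ-≤ 0≤z x≤y = ≤-respˡ (*-comm _ _) (≤-respʳ (*-comm _ _) (*-monoʳ-≤ 0≤z x≤y))

  *-monoˡ-< : ∀ {x y z} → 0# < z → x < y → x * z < y * z
  *-monoˡ-< 0<z x<y = <-respˡ (*-comm _ _) (<-respʳ (*-comm _ _) (*-monoʳ-< 0<z x<y))

  *-cancelˡ-≤ : ∀ {x y z} → 0# < z → z * x ≤ z * y → x ≤ y
  *-cancelˡ-≤ 0<z zx≤zy = ≮⇒≥ (λ y<x → *-monoʳ-< 0<z y<x zx≤zy)

  *-cancelˡ-< : ∀ {x y z} → 0# ≤ z → z * x < z * y → x < y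
  *-cancelˡ-< 0≤z zx<zy y≤x = zx<zy (*-monoʳ-≤ 0≤z y≤x)

  *-cancelˡ-≈ : ∀ {x y z} → ¬ z ≈ 0# → z * x ≈ z * y → x ≈ y
  *-cancelˡ-≈ {x} {y} {z} z≉0 zx≈zy =
    trans (solve 2 (λ x y → x := (x :- y) :+ y) refl x y)
      (trans (+-congʳ (*-cancelˡ-0 z≉0 (trans (solve 3 (λ x y z → z :* (x :- y) := z :* x :- z :* y) refl x y z)
        (trans (+-congʳ zx≈zy) (-‿inverseʳ (z * y))))))
      (+-identityˡ y))

  square-mono-< : ∀ {x y} → 0# ≤ x → x < y → x * x < y * y
  square-mono-< {x} {y} 0≤x x<y =
    ≤-<-trans (*-monoʳ-≤ 0≤x (<⇒≤ x<y)) (*-monoˡ-< (≤-<-trans 0≤x x<y) x<y)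

  square-mono-≤ : ∀ {x y} → 0# ≤ x → x ≤ y → x * x ≤ y * y
  square-mono-≤ {x} {y} 0≤x x≤y =
    ≤-trans (*-monoʳ-≤ 0≤x x≤y) (*-monoˡ-≤ (≤-trans 0≤x x≤y) x≤y)

  square-cancel-≤ : ∀ {x y} → 0# ≤ y → x * x ≤ y * y → x ≤ y
  square-cancel-≤ 0≤y xx≤yy = ≮⇒≥ (λ y<x → square-mono-< 0≤y y<x xx≤yy)

  square-cancel-< : ∀ {x y} → 0# ≤ y → x * x < y * y → x < y
  square-cancel-< 0≤y xx<yy y≤x = xx<yy (square-mono-≤ 0≤y y≤x)

  ⁻¹-pos : ∀ {x} → 0# < x → 0# < x ⁻¹
  ⁻¹-pos {x} 0<x x⁻¹≤0 =
    0<1 (≤-respˡ (⁻¹-inverse x (pos⇒≉0 0<x))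
      (≤-respʳ (zeroʳ x) (*-monoʳ-≤ (<⇒≤ 0<x) x⁻¹≤0)))

  ι-nonneg : ∀ n → 0# ≤ ι n
  ι-nonneg zero    = ≤-refl
  ι-nonneg (suc n) = +-nonneg (<⇒≤ 0<1) (ι-nonneg n)

  ι-pos : ∀ n → 0# < ι (suc n)
  ι-pos n = +-pos-nonneg 0<1 (ι-nonneg n)

  ι-homo-+ : ∀ m n → ι (m Nat.+ n) ≈ ι m + ι n
  ι-homo-+ = ×-homo-+ 1#

  ι-mono-≤ : ∀ {m n} → m Nat.≤ n → ι m ≤ ι n
  ι-mono-≤ {n = n} Nat.z≤n = ι-nonneg n
  ι-mono-≤ (Nat.s≤s m≤n)   = +-mono-≤ ≤-refl (ι-mono-≤ m≤n)

  ι-mono-< : ∀ {m n} → m Nat.< n → ι m < ι n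
  ι-mono-< {m} m<n = <-≤-trans (<-respˡ (+-identityˡ (ι m)) (+-mono-<-≤ 0<1 ≤-refl)) (ι-mono-≤ m<n)

  -- Reduces the rearrangement of an inequality to one identity between differences, which the ring
  -- solver settles.
  rearrange-≤ : ∀ {a b c d} → c ≤ d → d - c ≈ b - a → a ≤ b
  rearrange-≤ c≤d eq = nonneg-sub (≤-respʳ eq (sub-nonneg c≤d))

  rearrange-< : ∀ {a b c d} → c < d → d - c ≈ b - a → a < b
  rearrange-< c<d eq = pos-sub (<-respʳ eq (sub-pos c<d))

  inverse-pos : ∀ {x} → 0# < x → x * x ⁻¹ ≈ ι 1
  inverse-pos {x} 0<x = trans (⁻¹-inverse x (pos⇒≉0 0<x)) (sym (+-identityʳ 1#))

-- Sums, real matrices and linear systems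

module LinearAlgebra (ℝ : CompleteOrderedField) where
  open OrderedField ℝ
  open Spectral ℝ public
  open SumProperties semiring public using (sum-cong-≋; *-distribˡ-sum; *-distribʳ-sum)
  open import Relation.Binary.Reasoning.Setoid setoid

  sum-mono-≤ : ∀ {n} {f g : Vector Carrier n} → (∀ i → f i ≤ g i) → sum f ≤ sum g
  sum-mono-≤ {zero}  f≤g = ≤-refl
  sum-mono-≤ {suc n} f≤g = +-mono-≤ (f≤g zero) (sum-mono-≤ (f≤g ∘ suc))

  sum-mono-< : ∀ {n} {f g : Vector Carrier n} → (∀ i → f i ≤ g i) → ∀ j → f j < g j → sum f < sum g
  sum-mono-< f≤g zero    fj<gj = +-mono-<-≤ fj<gj (sum-mono-≤ (f≤g ∘ suc))
  sum-mono-< f≤g (suc j) fj<gj = +-mono-≤-< (f≤g zero) (sum-mono-< (f≤g ∘ suc) j fj<gj)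

  sum-≈⇒≈ : ∀ {n} {f g : Vector Carrier n} → (∀ i → f i ≤ g i) → sum f ≈ sum g → ∀ i → f i ≈ g i
  sum-≈⇒≈ {f = f} {g} f≤g Σf≈Σg i with f i ≈? g i
  ... | yes fi≈gi = fi≈gi
  ... | no  fi≉gi = ⊥-elim (<⇒≉ (sum-mono-< f≤g i (≤∧≉⇒< (f≤g i) fi≉gi)) Σf≈Σg)

  sum-zero : ∀ {n} {f : Vector Carrier n} → (∀ i → f i ≈ 0#) → sum f ≈ 0#
  sum-zero {zero}  f≈0 = refl
  sum-zero {suc n} f≈0 = trans (+-cong (f≈0 zero) (sum-zero (f≈0 ∘ suc))) (+-identityˡ 0#)

  sum-nonneg : ∀ {n} {f : Vector Carrier n} → (∀ i → 0# ≤ f i) → 0# ≤ sum f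
  sum-nonneg {zero}  f≥0 = ≤-refl
  sum-nonneg {suc n} f≥0 = +-nonneg (f≥0 zero) (sum-nonneg (f≥0 ∘ suc))

  sum-pos : ∀ {n} {f : Vector Carrier n} → (∀ i → 0# ≤ f i) → ∀ j → 0# < f j → 0# < sum f
  sum-pos {n} {f} f≥0 j fj>0 =
    <-respˡ (sum-zero {f = λ (_ : Fin n) → 0#} (λ _ → refl)) (sum-mono-< f≥0 j fj>0)

  sum-linear : ∀ {n} c (f g : Vector Carrier n) → sum (λ i → f i + c * g i) ≈ sum f + c * sum g
  sum-linear {zero}  c f g = solve 1 (λ c → con (+ 0) := con (+ 0) :+ c :* con (+ 0)) refl c
  sum-linear {suc n} c f g =
    trans (+-congˡ (sum-linear c (f ∘ suc) (g ∘ suc)))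
      (solve 5 (λ c x y u v → x :+ c :* y :+ (u :+ c :* v) := x :+ u :+ c :* (y :+ v)) refl
        c (f zero) (g zero) (sum (f ∘ suc)) (sum (g ∘ suc)))

  -- The index argument witnesses that there is something to maximise over.
  argmax : ∀ {n} (f : Vector Carrier n) → Fin n → ∃[ i ] (∀ j → f j ≤ f i)
  argmax {suc zero}    f _ = zero , λ { zero → ≤-refl }
  argmax {suc (suc n)} f _ with argmax (f ∘ suc) zero
  ... | i , max with total (f zero) (f (suc i))
  ...   | inj₁ f0≤fi = suc i , λ { zero → f0≤fi ; (suc j) → max j }
  ...   | inj₂ fi≤f0 = zero  , λ { zero → ≤-refl ; (suc j) → ≤-trans (max j) fi≤f0 }

  argmin : ∀ {n} (f : Vector Carrier n) → Fin n → ∃[ i ] (∀ j → f i ≤ f j)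
  argmin f i₀ with argmax (λ i → - f i) i₀
  ... | i , max = i , λ j → rearrange-≤ (max j) (solve 2 (λ x y → (:- x) :- (:- y) := y :- x) refl (f i) (f j))

  infixr 8 _⊛_

  _⊛_ : ∀ {n} → Matrix n → Vector Carrier n → Vector Carrier n
  (M ⊛ x) i = sum (λ j → M i j * x j)

  ⊛-linear : ∀ {n} (M : Matrix n) c x y i → (M ⊛ (λ j → x j + c * y j)) i ≈ (M ⊛ x) i + c * (M ⊛ y) i
  ⊛-linear M c x y i =
    trans (sum-cong-≋ (λ j → solve 4 (λ m c x y → m :* (x :+ c :* y) := m :* x :+ c :* (m :* y)) refl (M i j) c (x j) (y j)))
      (sum-linear c (λ j → M i j * x j) (λ j → M i j * y j))

  ⊛-scale : ∀ {n} (M : Matrix n) c x i → (M ⊛ (λ j → c * x j)) i ≈ c * (M ⊛ x) i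
  ⊛-scale M c x i =
    trans (sum-cong-≋ (λ j → solve 3 (λ m c x → m :* (c :* x) := c :* (m :* x)) refl (M i j) c (x j)))
      (sym (*-distribˡ-sum c (λ j → M i j * x j)))

  ⊛-diag : ∀ {n} (d x : Vector Carrier n) i → (diag d ⊛ x) i ≈ d i * x i
  ⊛-diag d x zero =
    trans (+-congˡ (sum-zero (λ j → zeroˡ (x (suc j))))) (+-identityʳ (d zero * x zero))
  ⊛-diag d x (suc i) =
    trans (+-cong (zeroˡ (x zero)) (⊛-diag (d ∘ suc) (x ∘ suc) i)) (+-identityˡ _)

  NonNegative : ∀ {n} → Matrix n → Set
  NonNegative M = ∀ i j → 0# ≤ M i j

  Positive : ∀ {n} → Vector Carrier n → Set
  Positive x = ∀ i → 0# < x i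

  ⊛-mono-≤ : ∀ {n} {M : Matrix n} → NonNegative M →
             ∀ {x y} → (∀ j → x j ≤ y j) → ∀ i → (M ⊛ x) i ≤ (M ⊛ y) i
  ⊛-mono-≤ M≥0 x≤y i = sum-mono-≤ (λ j → *-monoʳ-≤ (M≥0 i j) (x≤y j))

  negate-≤ : ∀ {a b} → a ≤ - b → b ≤ - a
  negate-≤ {a} {b} a≤-b = rearrange-≤ a≤-b (solve 2 (λ a b → (:- b) :- a := (:- a) :- b) refl a b)

  infimum : (P : Carrier → Set) → ∃[ x ] P x → ∃[ b ] (∀ x → P x → b ≤ x) →
            ∃[ t ] ((∀ x → P x → t ≤ x) × (∀ b → (∀ x → P x → b ≤ x) → b ≤ t))
  infimum P (a , Pa) (b , lower) = conclude
    (supremum N (- a , N-intro Pa) (- b , λ { s (x , s≈-x , Px) → ≤-respˡ (sym s≈-x) (neg-anti (lower x Px)) }))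
    where
    N : Carrier → Set
    N s = ∃[ x ] (s ≈ - x × P x)
    N-intro : ∀ {x} → P x → N (- x)
    N-intro {x} Px = x , refl , Px
    neg-anti : ∀ {x y} → x ≤ y → - y ≤ - x
    neg-anti {x} {y} x≤y = rearrange-≤ x≤y (solve 2 (λ x y → y :- x := (:- x) :- (:- y)) refl x y)
    conclude : ∃[ s ] (UpperBound N s × (∀ b → UpperBound N b → s ≤ b)) →
               ∃[ t ] ((∀ x → P x → t ≤ x) × (∀ b → (∀ x → P x → b ≤ x) → b ≤ t))
    conclude (s , upper , least) = - s ,
      (λ x Px → rearrange-≤ (upper (- x) (N-intro Px)) (solve 2 (λ s x → s :- (:- x) := x :- (:- s)) refl s x)) ,
      (λ b below → negate-≤ (least (- b) λ { t (x , t≈-x , Px) → ≤-respˡ (sym t≈-x) (neg-anti (below x Px)) }))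

  -- Gaussian elimination.

  Solution : ∀ {n} → Matrix n → Vector Carrier n → Set
  Solution M b = ∃[ x ] (∀ i → (M ⊛ x) i ≈ b i)

  Kernel : ∀ {n} → Matrix n → Set
  Kernel M = ∃[ x ] ((∃[ j ] ¬ x j ≈ 0#) × (∀ i → (M ⊛ x) i ≈ 0#))

  module Elimination {n} (M : Matrix (suc n)) (pivot : Fin (suc n)) (pivot≉0 : ¬ M pivot zero ≈ 0#) where

    multiplier : Fin n → Carrier
    multiplier j = M (punchIn pivot j) zero * M pivot zero ⁻¹

    reduced : Matrix n
    reduced j k = M (punchIn pivot j) (suc k) + - multiplier j * M pivot (suc k)

    reducedRHS : Vector Carrier (suc n) → Vector Carrier n
    reducedRHS b j = b (punchIn pivot j) + - multiplier j * b pivot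

    backSubstitute : Vector Carrier (suc n) → Vector Carrier n → Vector Carrier (suc n)
    backSubstitute b x = (M pivot zero ⁻¹ * (b pivot - sum (λ k → M pivot (suc k) * x k))) ∷ᶠ x

    backSubstitute-solves : ∀ b x → (∀ j → (reduced ⊛ x) j ≈ reducedRHS b j) →
                            ∀ i → (M ⊛ backSubstitute b x) i ≈ b i
    backSubstitute-solves b x solves i with pivot ≟ i
    ... | yes ≡.refl = begin
      a * (a ⁻¹ * (b i - S)) + S   ≈⟨ solve 4 (λ a c b s → a :* (c :* (b :- s)) :+ s := a :* c :* (b :- s) :+ s) refl a (a ⁻¹) (b i) S ⟩
      a * a ⁻¹ * (b i - S) + S     ≈⟨ +-congʳ (*-congʳ (⁻¹-inverse a pivot≉0)) ⟩
      1# * (b i - S) + S           ≈⟨ +-congʳ (*-identityˡ (b i - S)) ⟩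
      b i - S + S                  ≈⟨ solve 2 (λ b s → b :- s :+ s := b) refl (b i) S ⟩
      b i                          ∎
      where
      a = M i zero
      S = sum (λ k → M i (suc k) * x k)
    ... | no pivot≢i = ≡.subst (λ i → (M ⊛ backSubstitute b x) i ≈ b i) (Finₚ.punchIn-punchOut pivot≢i) row
      where
      j = punchOut pivot≢i
      i′ = punchIn pivot j
      a = M pivot zero
      m = M i′ zero
      S = sum (λ k → M pivot (suc k) * x k)
      S′ = sum (λ k → M i′ (suc k) * x k)
      reduced-row : S′ + - multiplier j * S ≈ reducedRHS b j
      reduced-row = trans
        (sym (trans
          (sum-cong-≋ (λ k → solve 4 (λ p c q x → (p :+ c :* q) :* x := p :* x :+ c :* (q :* x)) refl
            (M i′ (suc k)) (- multiplier j) (M pivot (suc k)) (x k)))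
          (sum-linear (- multiplier j) (λ k → M i′ (suc k) * x k) (λ k → M pivot (suc k) * x k))))
        (solves j)
      row : m * (a ⁻¹ * (b pivot - S)) + S′ ≈ b i′
      row = begin
        m * (a ⁻¹ * (b pivot - S)) + S′
          ≈⟨ solve 5 (λ m c b s t → m :* (c :* (b :- s)) :+ t := m :* c :* b :+ (t :+ (:- (m :* c)) :* s)) refl
               m (a ⁻¹) (b pivot) S S′ ⟩
        m * a ⁻¹ * b pivot + (S′ + - multiplier j * S)
          ≈⟨ +-congˡ reduced-row ⟩
        m * a ⁻¹ * b pivot + (b i′ + - multiplier j * b pivot)
          ≈⟨ solve 3 (λ c b d → c :* b :+ (d :+ (:- c) :* b) := d) refl (m * a ⁻¹) (b pivot) (b i′) ⟩
        b i′ ∎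

  -- The Fredholm alternative, in place of determinants. A vanishing first column puts the first
  -- unit vector into the kernel; otherwise a pivot reduces the size by one, and back substitution
  -- lifts either outcome, with right-hand side zero for a kernel vector.
  solution-or-kernel : ∀ {n} (M : Matrix n) b → Solution M b ⊎ Kernel M
  solution-or-kernel {zero}  M b = inj₁ ((λ ()) , λ ())
  solution-or-kernel {suc n} M b with Finₚ.any? (λ i → ¬? (M i zero ≈? 0#))
  ... | no column≈0 = inj₂ (1# ∷ᶠ (λ _ → 0#) , (zero , λ 1≈0 → 0≉1 (sym 1≈0)) , λ i →
          trans (+-cong (trans (*-identityʳ (M i zero)) (M≈0 i)) (sum-zero (λ k → zeroʳ (M i (suc k))))) (+-identityˡ 0#))
    where
    M≈0 : ∀ i → M i zero ≈ 0#
    M≈0 i with M i zero ≈? 0#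
    ... | yes M≈0 = M≈0
    ... | no  M≉0 = ⊥-elim (column≈0 (i , M≉0))
  ... | yes (pivot , pivot≉0) with solution-or-kernel (Elimination.reduced M pivot pivot≉0) (Elimination.reducedRHS M pivot pivot≉0 b)
  ...   | inj₁ (x , solves) = inj₁ (backSubstitute b x , backSubstitute-solves b x solves)
    where open Elimination M pivot pivot≉0
  ...   | inj₂ (x , (j , xj≉0) , solves) =
          inj₂ (backSubstitute (λ _ → 0#) x , (suc j , xj≉0) ,
                backSubstitute-solves (λ _ → 0#) x (λ j → trans (solves j)
                  (solve 1 (λ c → con (+ 0) := con (+ 0) :+ (:- c) :* con (+ 0)) refl (multiplier j))))
    where open Elimination M pivot pivot≉0

  Eigenpair : ∀ {n} → Matrix n → Carrier → Vector Carrier n → Set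
  Eigenpair M t x = (∃[ j ] ¬ x j ≈ 0#) × (∀ i → (M ⊛ x) i ≈ t * x i)

  -- The Perron root of a nonnegative matrix as an infimum

  module Perron {n} (i₀ : Fin n) (M : Matrix n) (M≥0 : NonNegative M) where

    -- The numbers `t` that admit such a `y` are those above the Perron root, in the spirit of
    -- Collatz and Wielandt.
    StrictlySuper : Carrier → Vector Carrier n → Set
    StrictlySuper t y = Positive y × (∀ i → (M ⊛ y) i < t * y i)

    -- Comparison at an index minimising w i / y i.
    super⇒positive : ∀ {t y} → StrictlySuper t y → ∀ w → (∀ i → (M ⊛ w) i < t * w i) → Positive w
    super⇒positive {t} {y} (y>0 , My<ty) w Mw<tw j = <-≤-trans (*-pos c>0 (y>0 j)) (c*y≤w j)
      where
      minimum = argmin (λ i → w i * y i ⁻¹) i₀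
      i = proj₁ minimum
      c = w i * y i ⁻¹
      ratio : ∀ j → w j * y j ⁻¹ * y j ≈ w j
      ratio j = begin
        w j * y j ⁻¹ * y j     ≈⟨ solve 3 (λ w v y → w :* v :* y := w :* (y :* v)) refl (w j) (y j ⁻¹) (y j) ⟩
        w j * (y j * y j ⁻¹)   ≈⟨ *-congˡ (inverse-pos (y>0 j)) ⟩
        w j * ι 1              ≈⟨ solve 1 (λ w → w :* con (+ 1) := w) refl (w j) ⟩
        w j                    ∎
      c*y≤w : ∀ j → c * y j ≤ w j
      c*y≤w j = ≤-respʳ (ratio j) (*-monoˡ-≤ (<⇒≤ (y>0 j)) (proj₂ minimum j))
      c>0 : 0# < c
      c>0 c≤0 = Mw<tw i
        (≤-trans (≤-respˡ (trans (solve 3 (λ c t y → c :* (t :* y) := t :* (c :* y)) refl c t (y i)) (*-congˡ (ratio i))) step)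
          (≤-respˡ (⊛-scale M c y i) (⊛-mono-≤ M≥0 c*y≤w i)))
        where
        step : c * (t * y i) ≤ c * (M ⊛ y) i
        step = nonneg-sub (≤-respʳ (solve 3 (λ c u v → (con (+ 0) :- c) :* (u :- v) := c :* v :- c :* u) refl c (t * y i) ((M ⊛ y) i))
          (*-nonneg (0# - c) _ (sub-nonneg c≤0) (sub-nonneg (<⇒≤ (My<ty i)))))

    -- If `t < l`, then `w = − x` satisfies `M w < t w`, so `super⇒positive` would make `− x`
    -- positive, against `x > 0`.
    super-bound : ∀ {t y} → StrictlySuper t y →
                  ∀ {l x} → Positive x → (∀ i → l * x i ≤ (M ⊛ x) i) → l ≤ t
    super-bound {t} super {l} {x} x>0 lx≤Mx = ≮⇒≥ λ t<l →
      super⇒positive super (λ j → - ι 1 * x j)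
        (λ i → rearrange-< (<-≤-trans (*-monoˡ-< (x>0 i) t<l) (lx≤Mx i))
          (trans (solve 3 (λ m t x → m :- t :* x := t :* (con -[1+ 0 ] :* x) :- con -[1+ 0 ] :* m) refl ((M ⊛ x) i) t (x i))
            (+-congˡ (-‿cong (sym (⊛-scale M (- ι 1) x i))))))
        i₀ (rearrange-≤ (<⇒≤ (x>0 i₀)) (solve 1 (λ x → x :- con (+ 0) := con (+ 0) :- con -[1+ 0 ] :* x) refl (x i₀)))

    exists-super : ∃[ t ] ∃[ y ] StrictlySuper t y
    exists-super with argmax (M ⊛ (λ _ → 1#)) i₀
    ... | i , max = (M ⊛ (λ _ → 1#)) i + 1# , (λ _ → 1#) , (λ _ → 0<1) , λ j →
      <-respʳ (sym (*-identityʳ _)) (<-respˡ (+-identityʳ _) (+-mono-≤-< (max j) 0<1))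

    module AtInfimum (τ : Carrier) (τ-lower : ∀ {t y} → StrictlySuper t y → τ ≤ t)
                     (τ-greatest : ∀ b → (∀ {t y} → StrictlySuper t y → b ≤ t) → b ≤ τ) where

      shifted : Matrix n
      shifted i j = diag (λ _ → τ) i j + - ι 1 * M i j

      shifted-⊛ : ∀ y i → (shifted ⊛ y) i ≈ τ * y i - (M ⊛ y) i
      shifted-⊛ y i = begin
        sum (λ j → (diag (λ _ → τ) i j + - ι 1 * M i j) * y j)
          ≈⟨ sum-cong-≋ (λ j → solve 3 (λ d m y → (d :+ con -[1+ 0 ] :* m) :* y := d :* y :+ con -[1+ 0 ] :* (m :* y)) refl
               (diag (λ _ → τ) i j) (M i j) (y j)) ⟩
        sum (λ j → diag (λ _ → τ) i j * y j + - ι 1 * (M i j * y j))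
          ≈⟨ sum-linear (- ι 1) (λ j → diag (λ _ → τ) i j * y j) (λ j → M i j * y j) ⟩
        (diag (λ _ → τ) ⊛ y) i + - ι 1 * (M ⊛ y) i
          ≈⟨ +-congʳ (⊛-diag (λ _ → τ) y i) ⟩
        τ * y i + - ι 1 * (M ⊛ y) i
          ≈⟨ solve 2 (λ a b → a :+ con -[1+ 0 ] :* b := a :- b) refl (τ * y i) ((M ⊛ y) i) ⟩
        τ * y i - (M ⊛ y) i ∎

      -- A solution w of τ w − M w = 1 is positive, since it satisfies M w < t w for every
      -- t ≥ τ close to τ; but then M w < t w also for some t < τ.
      no-solution : ¬ Solution shifted (λ _ → ι 1)
      no-solution (w , solves) = no-room
        where
        Mw≈ : ∀ i → (M ⊛ w) i ≈ τ * w i - ι 1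
        Mw≈ i = begin
          (M ⊛ w) i                          ≈⟨ solve 2 (λ m t → m := t :- (t :- m)) refl ((M ⊛ w) i) (τ * w i) ⟩
          τ * w i - (τ * w i - (M ⊛ w) i)    ≈⟨ +-congˡ (-‿cong (trans (sym (shifted-⊛ w i)) (solves i))) ⟩
          τ * w i - ι 1                      ∎

        w>0 : Positive w
        w>0 i wi≤0 = η>0 (rearrange-≤ (τ-greatest (τ + η) (λ super → ≮⇒≥ (near super)))
                              (solve 2 (λ t e → t :- (t :+ e) := con (+ 0) :- e) refl τ η))
          where
          k = proj₁ (argmin w i)
          min = proj₂ (argmin w i)
          -- For `τ ≤ t < τ + 1 / B` the vector `t w − M w = 1 + (t − τ) w` stays positive, because
          -- `w ≥ w k = 1 − B` in every entry. By `super⇒positive` no admissible `t` can then lie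
          -- this close to `τ`.
          B = ι 1 - w k
          B>0 : 0# < B
          B>0 = +-pos-nonneg (ι-pos 0) (≤-respʳ (+-identityˡ (- w k)) (sub-nonneg (≤-trans (min i) wi≤0)))
          η = B ⁻¹
          η>0 : 0# < η
          η>0 = ⁻¹-pos B>0
          near : ∀ {t y} → StrictlySuper t y → ¬ t < τ + η
          near {t} super t<τ+η = super⇒positive super w
            (λ j → rearrange-<
              (<-respˡ (+-identityˡ 0#) (+-mono-<-≤ (sub-pos gap) (+-nonneg t-τ≥0 (*-nonneg _ _ t-τ≥0 (sub-nonneg (min j))))))
              (trans
                (solve 4 (λ t s u v → con (+ 1) :- (t :- s) :* (con (+ 1) :- u) :+ ((t :- s) :+ (t :- s) :* (v :- u)) :- con (+ 0)
                    := t :* v :- (s :* v :- con (+ 1)))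
                  refl t τ (w k) (w j))
                (+-congˡ (-‿cong (sym (Mw≈ j))))))
            i wi≤0
            where
            t-τ≥0 : 0# ≤ t - τ
            t-τ≥0 = sub-nonneg (τ-lower super)
            gap : (t - τ) * B < ι 1
            gap = <-respʳ (trans (*-comm η B) (inverse-pos B>0))
              (*-monoˡ-< B>0 (rearrange-< t<τ+η (solve 3 (λ t s e → s :+ e :- t := e :- (t :- s)) refl t τ η)))

        no-room : ⊥
        no-room = ⁻¹-pos A>0 (rearrange-≤ (τ-lower super) (solve 2 (λ t d → t :- d :- t := con (+ 0) :- d) refl τ δ))
          where
          k = proj₁ (argmax w i₀)
          max = proj₂ (argmax w i₀)
          -- Lowering `τ` by `δ = 1 / A` costs at most `δ w k = 1 − δ` in each row, which leaves at
          -- least `δ` of the right-hand side 1.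
          A = ι 1 + w k
          A>0 : 0# < A
          A>0 = +-pos-nonneg (ι-pos 0) (<⇒≤ (w>0 k))
          δ = A ⁻¹
          super : StrictlySuper (τ - δ) w
          super = w>0 , λ j → rearrange-<
            (+-mono-≤-< (*-monoʳ-≤ (<⇒≤ (⁻¹-pos A>0)) (max j)) (⁻¹-pos A>0))
            (begin
              δ * w k + δ - (δ * w j + 0#)          ≈⟨ solve 3 (λ d u v → d :* u :+ d :- (d :* v :+ con (+ 0)) := (con (+ 1) :+ u) :* d :- d :* v) refl δ (w k) (w j) ⟩
              A * δ - δ * w j                       ≈⟨ +-congʳ (inverse-pos A>0) ⟩
              ι 1 - δ * w j                         ≈⟨ solve 3 (λ d t v → con (+ 1) :- d :* v := (t :- d) :* v :- (t :* v :- con (+ 1))) refl δ τ (w j) ⟩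
              (τ - δ) * w j - (τ * w j - ι 1)       ≈⟨ +-congˡ (-‿cong (sym (Mw≈ j))) ⟩
              (τ - δ) * w j - (M ⊛ w) j             ∎)

      -- As `τ y − M y = 1` has no solution, `τ − M` is singular, and a kernel vector is an
      -- eigenvector.
      eigenpair : ∃[ y ] Eigenpair M τ y
      eigenpair with solution-or-kernel shifted (λ _ → ι 1)
      ... | inj₁ solution = ⊥-elim (no-solution solution)
      ... | inj₂ (y , y≉0 , kernel) = y , y≉0 , λ i → begin
        (M ⊛ y) i                          ≈⟨ solve 2 (λ m t → m := t :- (t :- m)) refl ((M ⊛ y) i) (τ * y i) ⟩
        τ * y i - (τ * y i - (M ⊛ y) i)    ≈⟨ +-congˡ (-‿cong (trans (sym (shifted-⊛ y i)) (kernel i))) ⟩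
        τ * y i - 0#                       ≈⟨ solve 1 (λ a → a :- con (+ 0) := a) refl (τ * y i) ⟩
        τ * y i                            ∎

    eigenvalue-above : ∀ {l x} → Positive x → (∀ i → l * x i ≤ (M ⊛ x) i) →
                       ∃[ t ] ∃[ y ] (l ≤ t × Eigenpair M t y)
    eigenvalue-above {l} x>0 lx≤Mx =
      conclude (infimum (λ t → ∃[ y ] StrictlySuper t y) exists-super (l , λ { t (y , super) → above super }))
      where
      above : ∀ {t y} → StrictlySuper t y → l ≤ t
      above super = super-bound super x>0 lx≤Mx
      conclude : ∃[ τ ] ((∀ t → ∃[ y ] StrictlySuper t y → τ ≤ t) ×
                         (∀ b → (∀ t → ∃[ y ] StrictlySuper t y → b ≤ t) → b ≤ τ)) →
                 ∃[ t ] ∃[ y ] (l ≤ t × Eigenpair M t y)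
      conclude (τ , lower , greatest) =
        τ , proj₁ eigenpair , τ-greatest l above , proj₂ eigenpair
        where
        τ-lower : ∀ {t y} → StrictlySuper t y → τ ≤ t
        τ-lower super = lower _ (_ , super)
        τ-greatest : ∀ b → (∀ {t y} → StrictlySuper t y → b ≤ t) → b ≤ τ
        τ-greatest b below = greatest b (λ { t (y , super) → below super })
        open AtInfimum τ τ-lower τ-greatest

    -- With v = M x − l x, the vector x + M x witnesses the strict inequality, as v + M v > 0.
    eigenvalue-strictly-above : (∀ i j → ¬ i ≡ j → 0# < M i j) →
      ∀ {l x} → Positive x → (∀ i → l * x i ≤ (M ⊛ x) i) → ∀ k → l * x k < (M ⊛ x) k →
      ∃[ t ] ∃[ y ] (l < t × Eigenpair M t y)
    eigenvalue-strictly-above M>0 {l} {x} x>0 lx≤Mx k lxk<Mxk = strict (eigenvalue-above x′>0 l′x′≤Mx′)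
      where
      v x′ : Vector Carrier n
      v i = (M ⊛ x) i + - l * x i
      x′ i = x i + ι 1 * (M ⊛ x) i
      v≈ : ∀ i → (M ⊛ x) i - l * x i ≈ v i
      v≈ i = solve 3 (λ m l x → m :- l :* x := m :+ (:- l) :* x) refl ((M ⊛ x) i) l (x i)
      v≥0 : ∀ i → 0# ≤ v i
      v≥0 i = ≤-respʳ (v≈ i) (sub-nonneg (lx≤Mx i))
      vk>0 : 0# < v k
      vk>0 = <-respʳ (v≈ k) (sub-pos lxk<Mxk)
      Mx≥0 : ∀ i → 0# ≤ (M ⊛ x) i
      Mx≥0 i = sum-nonneg (λ j → *-nonneg _ _ (M≥0 i j) (<⇒≤ (x>0 j)))
      x′>0 : Positive x′
      x′>0 i = +-pos-nonneg (x>0 i) (*-nonneg _ _ (ι-nonneg 1) (Mx≥0 i))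
      Mv-term≥0 : ∀ i j → 0# ≤ M i j * v j
      Mv-term≥0 i j = *-nonneg _ _ (M≥0 i j) (v≥0 j)
      gain : Vector Carrier n
      gain i = v i + (M ⊛ v) i
      gain>0 : Positive gain
      gain>0 i with i ≟ k
      ... | yes ≡.refl = +-pos-nonneg vk>0
            (sum-nonneg (Mv-term≥0 i))
      ... | no i≢k = +-nonneg-pos (v≥0 i)
            (sum-pos (Mv-term≥0 i) k (*-pos (M>0 i k i≢k) vk>0))
      minimum = argmin (λ i → gain i * x′ i ⁻¹) i₀
      i = proj₁ minimum
      -- The least ratio of `gain` to `x′`, so that `M x′ = l x′ + gain ≥ (l + η) x′` in every row
      -- and the weak version applies to `l + η`.
      η = gain i * x′ i ⁻¹
      η>0 : 0# < η
      η>0 = *-pos (gain>0 i) (⁻¹-pos (x′>0 i))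
      Mx′≈ : ∀ j → (M ⊛ x′) j ≈ l * x′ j + gain j
      Mx′≈ j = begin
        (M ⊛ x′) j                               ≈⟨ ⊛-linear M (ι 1) x (M ⊛ x) j ⟩
        (M ⊛ x) j + ι 1 * (M ⊛ (M ⊛ x)) j        ≈⟨ solve 4 (λ x y z l → y :+ con (+ 1) :* z := l :* (x :+ con (+ 1) :* y) :+ (y :+ (:- l) :* x :+ (z :+ (:- l) :* y))) refl
                                                      (x j) ((M ⊛ x) j) ((M ⊛ (M ⊛ x)) j) l ⟩
        l * x′ j + (v j + ((M ⊛ (M ⊛ x)) j + - l * (M ⊛ x) j))
                                                 ≈⟨ +-congˡ (+-congˡ (⊛-linear M (- l) (M ⊛ x) x j)) ⟨
        l * x′ j + gain j                        ∎
      l′x′≤Mx′ : ∀ j → (l + η) * x′ j ≤ (M ⊛ x′) j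
      l′x′≤Mx′ j = ≤-respˡ (sym (distribʳ (x′ j) l η)) (≤-respʳ (sym (Mx′≈ j)) (+-mono-≤ ≤-refl
        (≤-respʳ (begin
            gain j * x′ j ⁻¹ * x′ j     ≈⟨ solve 3 (λ w v y → w :* v :* y := w :* (y :* v)) refl (gain j) (x′ j ⁻¹) (x′ j) ⟩
            gain j * (x′ j * x′ j ⁻¹)   ≈⟨ *-congˡ (inverse-pos (x′>0 j)) ⟩
            gain j * ι 1                ≈⟨ solve 1 (λ w → w :* con (+ 1) := w) refl (gain j) ⟩
            gain j                      ∎)
          (*-monoˡ-≤ (<⇒≤ (x′>0 j)) (proj₂ minimum j)))))
      strict : ∃[ t ] ∃[ y ] (l + η ≤ t × Eigenpair M t y) → ∃[ t ] ∃[ y ] (l < t × Eigenpair M t y)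
      strict (t , y , l+η≤t , eigen) =
        t , y , <-≤-trans (<-respˡ (+-identityʳ l) (+-mono-≤-< ≤-refl η>0)) l+η≤t , eigen

-- From row inequalities to the spectral radius

module RadiusBounds (ℝ : CompleteOrderedField) where
  open OrderedField ℝ
  open LinearAlgebra ℝ
  open import Relation.Binary.Reasoning.Setoid setoid

  re-*ᵥ : ∀ {n} (m : Vector Carrier n) (x : Vector ℂ n) →
          re (foldr _+ℂ_ (fromReal 0#) (λ j → fromReal (m j) *ℂ x j)) ≈ sum (λ j → m j * re (x j))
  re-*ᵥ {zero}  m x = refl
  re-*ᵥ {suc n} m x = +-cong
    (solve 3 (λ m a b → m :* a :- con (+ 0) :* b := m :* a) refl (m zero) (re (x zero)) (im (x zero)))
    (re-*ᵥ (m ∘ suc) (x ∘ suc))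

  im-*ᵥ : ∀ {n} (m : Vector Carrier n) (x : Vector ℂ n) →
          im (foldr _+ℂ_ (fromReal 0#) (λ j → fromReal (m j) *ℂ x j)) ≈ sum (λ j → m j * im (x j))
  im-*ᵥ {zero}  m x = refl
  im-*ᵥ {suc n} m x = +-cong
    (solve 3 (λ m a b → m :* b :+ con (+ 0) :* a := m :* b) refl (m zero) (re (x zero)) (im (x zero)))
    (im-*ᵥ (m ∘ suc) (x ∘ suc))

  eigenpair⇒eigenvalue : ∀ {n} {M : Matrix n} {t y} → Eigenpair M t y → IsEigenvalue M (fromReal t)
  eigenpair⇒eigenvalue {M = M} {t} {y} ((j , yj≉0) , My≈ty) =
    fromReal ∘ y , (λ y≈0 → yj≉0 (proj₁ (y≈0 j))) , λ i →
      trans (re-*ᵥ (M i) (fromReal ∘ y))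
        (trans (My≈ty i) (solve 2 (λ t y → t :* y := t :* y :- con (+ 0) :* con (+ 0)) refl t (y i))) ,
      trans (im-*ᵥ (M i) (fromReal ∘ y))
        (trans (sum-zero (λ j → zeroʳ (M i j)))
          (solve 2 (λ t y → con (+ 0) := t :* con (+ 0) :+ con (+ 0) :* y) refl t (y i)))

  -- A nonnegative real eigenvalue is its own modulus, to which the maximality of `ρ` applies.
  eigenpair-≤ : ∀ {n} {M : Matrix n} {t y ρ} → 0# ≤ t → Eigenpair M t y → IsSpectralRadius M ρ → t ≤ ρ
  eigenpair-≤ {t = t} 0≤t eigen (_ , max) = max (fromReal t) t (eigenpair⇒eigenvalue eigen)
    (0≤t , solve 1 (λ t → t :* t := t :^ 2 :+ con (+ 0) :^ 2) refl t)

  module RadiusBelow {n} (i₀ : Fin n) {M : Matrix n} (M≥0 : NonNegative M) {ρ} (radius : IsSpectralRadius M ρ)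
                     {l x} (0≤l : 0# ≤ l) (x>0 : Positive x) (lx≤Mx : ∀ i → l * x i ≤ (M ⊛ x) i) where
    open Perron i₀ M M≥0

    radius-≥ : l ≤ ρ
    radius-≥ =
      let (t , y , l≤t , eigen) = eigenvalue-above x>0 lx≤Mx
      in ≤-trans l≤t (eigenpair-≤ (≤-trans 0≤l l≤t) eigen radius)

    -- A single strict row would produce an eigenvalue beyond `l`, hence beyond `ρ`.
    radius-≈ : (∀ i j → ¬ i ≡ j → 0# < M i j) → ρ ≈ l → ∀ i → (M ⊛ x) i ≈ l * x i
    radius-≈ M>0 ρ≈l i = antisym (≮⇒≥ not-less) (lx≤Mx i)
      where
      not-less : ¬ l * x i < (M ⊛ x) i
      not-less lx<Mx =
        let (t , y , l<t , eigen) = eigenvalue-strictly-above M>0 x>0 lx≤Mx i lx<Mx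
        in <⇒≉ (<-≤-trans l<t (eigenpair-≤ (≤-trans 0≤l (<⇒≤ l<t)) eigen radius)) (sym ρ≈l)

  module ComplexEigenvector {n} {M : Matrix n} (M≥0 : NonNegative M) {x : Vector Carrier n} (x>0 : Positive x)
    {a b ρ} (ρ>0 : 0# < ρ) (ρ²≈ : ρ * ρ ≈ a * a + b * b) (A B : Vector Carrier n)
    (MA≈ : ∀ i → (M ⊛ A) i ≈ a * A i - b * B i) (MB≈ : ∀ i → (M ⊛ B) i ≈ a * B i + b * A i) where

    -- `u + i w` is the eigenvector `A + i B` divided entrywise by `x`, and `N` its squared modulus;
    -- working with squares avoids taking roots.
    u w N : Vector Carrier n
    u j = A j * x j ⁻¹
    w j = B j * x j ⁻¹
    N j = u j * u j + w j * w j

    unscale : ∀ y j → y * x j ⁻¹ * x j ≈ y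
    unscale y j = begin
      y * x j ⁻¹ * x j     ≈⟨ solve 3 (λ y v x → y :* v :* x := y :* (x :* v)) refl y (x j ⁻¹) (x j) ⟩
      y * (x j * x j ⁻¹)   ≈⟨ *-congˡ (inverse-pos (x>0 j)) ⟩
      y * ι 1              ≈⟨ solve 1 (λ y → y :* con (+ 1) := y) refl y ⟩
      y                    ∎

    N≈0⇒≈0 : ∀ j → N j ≤ 0# → A j ≈ 0# × B j ≈ 0#
    N≈0⇒≈0 j N≤0 = vanish (A j) (square-≈0 (≤-trans (≤-respˡ (+-identityʳ _) (+-mono-≤ ≤-refl (square-nonneg (w j)))) N≤0)) ,
                   vanish (B j) (square-≈0 (≤-trans (≤-respˡ (+-identityˡ _) (+-mono-≤ (square-nonneg (u j)) ≤-refl)) N≤0))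
      where
      square-≈0 : ∀ {y} → y * y ≤ 0# → y ≈ 0#
      square-≈0 {y} yy≤0 with y ≈? 0#
      ... | yes y≈0 = y≈0
      ... | no  y≉0 = *-cancelˡ-0 y≉0 (antisym yy≤0 (square-nonneg y))
      vanish : ∀ y → y * x j ⁻¹ ≈ 0# → y ≈ 0#
      vanish y z = trans (sym (unscale y j)) (trans (*-congʳ z) (zeroˡ (x j)))

    -- Pairing the i-th eigenvector equation with its own right hand side (α , β) makes every
    -- term a real number, bounded by the Cauchy–Schwarz inequality.
    module Row (i : Fin n) (max : ∀ j → N j ≤ N i) (N>0 : 0# < N i) where
      α β : Carrier
      α = a * u i - b * w i
      β = a * w i + b * u i

      norm : α * α + β * β ≈ ρ * ρ * N i
      norm = trans (solve 4 (λ a b u w → (a :* u :- b :* w) :* (a :* u :- b :* w) :+ (a :* w :+ b :* u) :* (a :* w :+ b :* u)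
                                    := (a :* a :+ b :* b) :* (u :* u :+ w :* w)) refl a b (u i) (w i))
                   (*-congʳ (sym ρ²≈))

      -- Since `α + i β` is the eigenvalue times `u i + i w i`, this is the real part of its
      -- conjugate times the `j`-th entry.
      pairing : Vector Carrier n
      pairing j = α * u j + β * w j

      pairing² : ∀ j → pairing j * pairing j ≤ ρ * ρ * N i * N j
      -- Lagrange's identity: the two sides of the Cauchy-Schwarz inequality differ by the square of
      -- `α w j − β u j`.
      pairing² j = rearrange-≤ (square-nonneg (α * w j - β * u j))
        (trans (solve 4 (λ a b u w → (a :* w :- b :* u) :* (a :* w :- b :* u) :- con (+ 0)
                          := (a :* a :+ b :* b) :* (u :* u :+ w :* w) :- (a :* u :+ b :* w) :* (a :* u :+ b :* w)) refl
                 α β (u j) (w j))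
          (+-congʳ (*-congʳ norm)))

      bound : Carrier
      bound = ρ * N i

      bound>0 : 0# < bound
      bound>0 = *-pos ρ>0 N>0

      bound² : ρ * ρ * N i * N i ≈ bound * bound
      bound² = solve 2 (λ r m → r :* r :* m :* m := r :* m :* (r :* m)) refl ρ (N i)

      ρρN>0 : 0# < ρ * ρ * N i
      ρρN>0 = *-pos (*-pos ρ>0 ρ>0) N>0

      pairing-≤ : ∀ j → pairing j ≤ bound
      pairing-≤ j = square-cancel-≤ (<⇒≤ bound>0)
        (≤-trans (pairing² j) (≤-respʳ bound² (*-monoʳ-≤ (<⇒≤ ρρN>0) (max j))))

      pairing-< : ∀ j → N j < N i → pairing j < bound
      pairing-< j Nj<Ni = square-cancel-< (<⇒≤ bound>0)
        (≤-<-trans (pairing² j) (<-respʳ bound² (*-monoʳ-< ρρN>0 Nj<Ni)))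

      weight≥0 : ∀ j → 0# ≤ M i j * x j
      weight≥0 j = *-nonneg _ _ (M≥0 i j) (<⇒≤ (x>0 j))

      -- Undoing the division by `x` and applying the eigenvector equation turns the sum into
      -- `(α , β)` paired with itself, times `x i`; its squared norm is `ρ² N i`.
      Σ-pairing : sum (λ j → M i j * x j * pairing j) ≈ bound * (ρ * x i)
      Σ-pairing = begin
        sum (λ j → M i j * x j * pairing j)
          ≈⟨ sum-cong-≋ (λ j → solve 6 (λ m x α β u w → m :* x :* (α :* u :+ β :* w) := α :* (m :* (u :* x)) :+ β :* (m :* (w :* x))) refl
               (M i j) (x j) α β (u j) (w j)) ⟩
        sum (λ j → α * (M i j * (u j * x j)) + β * (M i j * (w j * x j)))
          ≈⟨ sum-cong-≋ (λ j → +-cong (*-congˡ (*-congˡ (unscale (A j) j))) (*-congˡ (*-congˡ (unscale (B j) j)))) ⟩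
        sum (λ j → α * (M i j * A j) + β * (M i j * B j))
          ≈⟨ sum-linear β (λ j → α * (M i j * A j)) (λ j → M i j * B j) ⟩
        sum (λ j → α * (M i j * A j)) + β * (M ⊛ B) i
          ≈⟨ +-congʳ (sym (*-distribˡ-sum α (λ j → M i j * A j))) ⟩
        α * (M ⊛ A) i + β * (M ⊛ B) i
          ≈⟨ +-cong (*-congˡ (MA≈ i)) (*-congˡ (MB≈ i)) ⟩
        α * (a * A i - b * B i) + β * (a * B i + b * A i)
          ≈⟨ +-cong (*-congˡ (+-cong (*-congˡ (sym (unscale (A i) i))) (-‿cong (*-congˡ (sym (unscale (B i) i))))))
                    (*-congˡ (+-cong (*-congˡ (sym (unscale (B i) i))) (*-congˡ (sym (unscale (A i) i))))) ⟩
        α * (a * (u i * x i) - b * (w i * x i)) + β * (a * (w i * x i) + b * (u i * x i))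
          ≈⟨ solve 7 (λ α β a b u w x → α :* (a :* (u :* x) :- b :* (w :* x)) :+ β :* (a :* (w :* x) :+ b :* (u :* x))
                       := (α :* (a :* u :- b :* w) :+ β :* (a :* w :+ b :* u)) :* x) refl α β a b (u i) (w i) (x i) ⟩
        (α * α + β * β) * x i
          ≈⟨ *-congʳ norm ⟩
        ρ * ρ * N i * x i
          ≈⟨ solve 3 (λ r m x → r :* r :* m :* x := r :* m :* (r :* x)) refl ρ (N i) (x i) ⟩
        bound * (ρ * x i) ∎

      Σ-bound : sum (λ j → M i j * x j * bound) ≈ bound * (M ⊛ x) i
      Σ-bound = trans (sym (*-distribʳ-sum bound (λ j → M i j * x j))) (*-comm _ bound)

      row-≤ : ρ * x i ≤ (M ⊛ x) i
      row-≤ = *-cancelˡ-≤ bound>0 (≤-respˡ Σ-pairing (≤-respʳ Σ-bound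
        (sum-mono-≤ (λ j → *-monoʳ-≤ (weight≥0 j) (pairing-≤ j)))))

      -- Equality in the row therefore forces `N j` to be maximal for every `j` with a positive
      -- entry in row `i`.
      row-< : ∀ j → 0# < M i j → N j < N i → ρ * x i < (M ⊛ x) i
      row-< j M>0 Nj<Ni = *-cancelˡ-< (<⇒≤ bound>0) (<-respˡ Σ-pairing (<-respʳ Σ-bound
        (sum-mono-< (λ j → *-monoʳ-≤ (weight≥0 j) (pairing-≤ j)) j (*-monoʳ-< (*-pos M>0 (x>0 j)) (pairing-< j Nj<Ni)))))

  module RadiusAbove {n} (i₀ : Fin n) {M : Matrix n} (M≥0 : NonNegative M) {ρ} (radius : IsSpectralRadius M ρ)
                     {l x} (0<l : 0# < l) (x>0 : Positive x) (Mx≤lx : ∀ i → (M ⊛ x) i ≤ l * x i) where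

    module _ (ρ>0 : 0# < ρ) where
      z : ℂ
      z = proj₁ (proj₁ radius)
      X : Vector ℂ n
      X = proj₁ (proj₁ (proj₂ (proj₁ radius)))
      X≉0 : ¬ (∀ i → X i ≈ℂ fromReal 0#)
      X≉0 = proj₁ (proj₂ (proj₁ (proj₂ (proj₁ radius))))
      MX≈ : ∀ i → (M *ᵥ X) i ≈ℂ z *ℂ X i
      MX≈ = proj₂ (proj₂ (proj₁ (proj₂ (proj₁ radius))))

      open ComplexEigenvector M≥0 x>0 ρ>0
        (trans (proj₂ (proj₂ (proj₂ (proj₁ radius)))) (solve 2 (λ a b → a :^ 2 :+ b :^ 2 := a :* a :+ b :* b) refl (re z) (im z)))
        (re ∘ X) (im ∘ X)
        (λ i → trans (sym (re-*ᵥ (M i) X)) (proj₁ (MX≈ i)))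
        (λ i → trans (sym (im-*ᵥ (M i) X)) (proj₂ (MX≈ i)))

      maximum = argmax N i₀

      maximum>0 : ∀ {i} → (∀ j → N j ≤ N i) → 0# < N i
      maximum>0 max N≤0 = X≉0 (λ j → N≈0⇒≈0 j (≤-trans (max j) N≤0))

      positive-radius-≤ : ρ ≤ l
      positive-radius-≤ = *-cancelˡ-≤ (x>0 i)
        (≤-respˡ (*-comm ρ (x i)) (≤-respʳ (*-comm l (x i)) (≤-trans (Row.row-≤ i max (maximum>0 max)) (Mx≤lx i))))
        where
        i = proj₁ maximum
        max = proj₂ maximum

      module _ (ρ≈l : ρ ≈ l) where
        lx≈ρx : ∀ i → l * x i ≈ ρ * x i
        lx≈ρx i = *-congʳ (sym ρ≈l)

        -- When `ρ = l`, a smaller `N j` after a positive entry would make row `i` strict.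
        -- Maximality of `N` thus travels along walks, and connectivity makes every index a
        -- maximiser, so `row-≤` becomes available in every row.
        maximum-closed : ∀ {i j} → Star (λ i j → 0# < M i j) i j → (∀ k → N k ≤ N i) → ∀ k → N k ≤ N j
        maximum-closed ε max = max
        maximum-closed {i} (_◅_ {j = j} Mij>0 path) max = maximum-closed path (λ k → ≤-trans (max k) (≮⇒≥ λ Nj<Ni →
          Row.row-< i max (maximum>0 max) j Mij>0 Nj<Ni (≤-respʳ (lx≈ρx i) (Mx≤lx i))))

        positive-radius-≈ : (∀ i j → Star (λ i j → 0# < M i j) i j) → ∀ i → (M ⊛ x) i ≈ l * x i
        positive-radius-≈ connected i = antisym (Mx≤lx i) (≤-respˡ (*-congʳ ρ≈l) (Row.row-≤ i max (maximum>0 max)))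
          where
          max : ∀ j → N j ≤ N i
          max = maximum-closed (connected (proj₁ maximum) i) (proj₂ maximum)

    -- The comparison cancels the factor `ρ N i`, so `ρ ≤ 0` is settled apart, by `0 < l`.
    radius-≤ : ρ ≤ l
    radius-≤ with ρ ≤? 0#
    ... | yes ρ≤0 = ≤-trans ρ≤0 (<⇒≤ 0<l)
    ... | no  ρ>0 = positive-radius-≤ ρ>0

    radius-≈ : (∀ i j → Star (λ i j → 0# < M i j) i j) → ρ ≈ l → ∀ i → (M ⊛ x) i ≈ l * x i
    radius-≈ connected ρ≈l = positive-radius-≈ (<-respʳ (sym ρ≈l) 0<l) ρ≈l connected

-- Test vectors and the sign of their excess

module TestNumbers (ℝ : CompleteOrderedField) where
  open OrderedField ℝ
  open import Relation.Binary.Reasoning.Setoid setoid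

  solve-ratio : ∀ x {y} → 0# < y → x / y * y ≈ x
  solve-ratio x {y} y>0 = begin
    x * y ⁻¹ * y       ≈⟨ solve 3 (λ x v y → x :* v :* y := x :* (y :* v)) refl x (y ⁻¹) y ⟩
    x * (y * y ⁻¹)     ≈⟨ *-congˡ (inverse-pos y>0) ⟩
    x * ι 1            ≈⟨ solve 1 (λ x → x :* con (+ 1) := x) refl x ⟩
    x                  ∎

  ratio-pos : ∀ {x y} → 0# < x → 0# < y → 0# < x / y
  ratio-pos x>0 y>0 = *-pos x>0 (⁻¹-pos y>0)

  double-cancel-< : ∀ {x y} → ι 2 * x < ι 2 * y → x < y
  double-cancel-< = *-cancelˡ-< (ι-nonneg 2)

  ≈⇒-≈0 : ∀ {x y} → x ≈ y → x - y ≈ 0#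
  ≈⇒-≈0 {x} {y} x≈y = trans (+-congʳ x≈y) (-‿inverseʳ y)

  -- m is the shifted eigenvalue l + 1 − c (n − 1), and e and c select one of the four matrices.
  -- In all four cases the test vector (1 on P and S, a on R) is an eigenvector up to the
  -- constant excess p + k + r a − m.
  record Test (e c p k r l : Carrier) : Set where
    field
      m a    : Carrier
      l≈     : l ≈ m - ι 1 + c * (p + (k + r) - ι 1)
      a>0    : 0# < a
      -- This makes an R row leave the same remainder as a P or S row: it is the extra term that
      -- `row-a` has to cancel. Being linear in `a`, it determines `a` in each of the four cases.
      a-eq   : a * m ≈ m + (e - ι 1) * p * (ι 1 + c * a)
      l>0    : 0# < l
    excess : Carrier
    excess = p + k + r * a - m
    -- A row of the model whose vertex has the value `x` and the weight `w` towards P. The block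
    -- sums count the vertex itself with weight 1, which the last term takes back.
    rowSum : Carrier → Carrier → Carrier
    rowSum w x = p * (w * (ι 1 + c * x)) + (k * (ι 1 * (ι 1 + c * x)) + r * (ι 1 * (a + c * x))) - (x + c * x)
    row-1 : rowSum (ι 1) (ι 1) ≈ l * ι 1 + excess
    row-1 = begin
      rowSum (ι 1) (ι 1)
        ≈⟨ solve 6 (λ p k r a c m →
             p :* (con (+ 1) :* (con (+ 1) :+ c :* con (+ 1))) :+ (k :* (con (+ 1) :* (con (+ 1) :+ c :* con (+ 1))) :+ r :* (con (+ 1) :* (a :+ c :* con (+ 1)))) :- (con (+ 1) :+ c :* con (+ 1))
             := (m :- con (+ 1) :+ c :* (p :+ (k :+ r) :- con (+ 1))) :* con (+ 1) :+ (p :+ k :+ r :* a :- m)) refl p k r a c m ⟩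
      (m - ι 1 + c * (p + (k + r) - ι 1)) * ι 1 + excess
        ≈⟨ +-congʳ (*-congʳ (sym l≈)) ⟩
      l * ι 1 + excess ∎
    row-a : rowSum e a ≈ l * a + excess
    row-a = begin
      rowSum e a
        ≈⟨ solve 7 (λ p k r a c m e →
             p :* (e :* (con (+ 1) :+ c :* a)) :+ (k :* (con (+ 1) :* (con (+ 1) :+ c :* a)) :+ r :* (con (+ 1) :* (a :+ c :* a))) :- (a :+ c :* a)
             := (m :- con (+ 1) :+ c :* (p :+ (k :+ r) :- con (+ 1))) :* a :+ (p :+ k :+ r :* a :- m)
                :+ (m :+ (e :- con (+ 1)) :* p :* (con (+ 1) :+ c :* a) :- a :* m)) refl p k r a c m e ⟩
      (m - ι 1 + c * (p + (k + r) - ι 1)) * a + excess + (m + (e - ι 1) * p * (ι 1 + c * a) - a * m)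
        ≈⟨ +-cong (+-congʳ (*-congʳ (sym l≈))) (≈⇒-≈0 (sym a-eq)) ⟩
      l * a + excess + 0#
        ≈⟨ +-identityʳ (l * a + excess) ⟩
      l * a + excess ∎

  module Parameters {p k r : Carrier} (p≥1 : ι 1 ≤ p) (k≥1 : ι 1 ≤ k) (r≥1 : ι 1 ≤ r) where

    n : Carrier
    n = p + (k + r)

    p-1≥0 : 0# ≤ p - ι 1
    p-1≥0 = sub-nonneg p≥1

    k-1≥0 : 0# ≤ k - ι 1
    k-1≥0 = sub-nonneg k≥1

    r-1≥0 : 0# ≤ r - ι 1
    r-1≥0 = sub-nonneg r≥1

    k>0 : 0# < k
    k>0 = <-≤-trans (ι-pos 0) k≥1

    p>0 : 0# < p
    p>0 = <-≤-trans (ι-pos 0) p≥1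

    n-3≥0 : 0# ≤ n - ι 3
    n-3≥0 = ≤-respʳ (solve 3 (λ p k r → p :- con (+ 1) :+ (k :- con (+ 1) :+ (r :- con (+ 1))) := p :+ (k :+ r) :- con (+ 3)) refl p k r)
      (+-nonneg p-1≥0 (+-nonneg k-1≥0 r-1≥0))

    p+r-1>0 : 0# < p + r - ι 1
    p+r-1>0 = <-respʳ (solve 2 (λ p r → p :+ (r :- con (+ 1)) := p :+ r :- con (+ 1)) refl p r) (+-pos-nonneg p>0 r-1≥0)

    -- In each of the four cases b is the rational part of 2 m, so that 2 m − b is the square root.
    root-> : ∀ {b d m t} → 0# ≤ ι 2 * m - b → (ι 2 * m - b) * (ι 2 * m - b) ≈ d →
             (t - b) * (t - b) < d → t < ι 2 * m
    root-> {b} {d} {m} {t} root≥0 root² below = rearrange-< (square-cancel-< root≥0 (<-respʳ (sym root²) below))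
      (solve 3 (λ x b t → x :- b :- (t :- b) := x :- t) refl (ι 2 * m) b t)

    root-< : ∀ {b d m t} → 0# ≤ t - b → (ι 2 * m - b) * (ι 2 * m - b) ≈ d →
             d < (t - b) * (t - b) → ι 2 * m < t
    root-< {b} {d} {m} {t} t-b≥0 root² above = rearrange-< (square-cancel-< t-b≥0 (<-respˡ (sym root²) above))
      (solve 3 (λ x b t → t :- b :- (x :- b) := t :- x) refl (ι 2 * m) b t)

    above-n-1⇒pos : ∀ {m} → n - ι 1 < m → 0# < m - p
    above-n-1⇒pos {m} n-1<m = <-respʳ (solve 4 (λ p k r m → m :- (p :+ (k :+ r) :- con (+ 1)) :+ (k :+ (r :- con (+ 1))) := m :- p) refl p k r m)
      (+-pos-nonneg (sub-pos n-1<m) (+-nonneg (<⇒≤ k>0) r-1≥0))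

    above-n-1⇒m-1>0 : ∀ {m} → n - ι 1 < m → 0# < m - ι 1
    above-n-1⇒m-1>0 {m} n-1<m = <-respʳ (solve 2 (λ n m → m :- (n :- con (+ 1)) :+ (n :- con (+ 3) :+ con (+ 1)) := m :- con (+ 1)) refl n m)
      (+-pos-nonneg (sub-pos n-1<m) (+-nonneg n-3≥0 (ι-nonneg 1)))

    above-n-1⇒m>0 : ∀ {m} → n - ι 1 < m → 0# < m
    above-n-1⇒m>0 {m} n-1<m = <-respʳ (solve 1 (λ m → m :- con (+ 1) :+ con (+ 1) := m) refl m)
      (+-pos-nonneg (above-n-1⇒m-1>0 n-1<m) (ι-nonneg 1))

    n-1-below : ∀ {m} → n < m → n - ι 1 < m
    n-1-below {m} n<m = pos-sub (<-respʳ (solve 2 (λ n m → m :- n :+ con (+ 1) := m :- (n :- con (+ 1))) refl n m)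
      (+-pos-nonneg (sub-pos n<m) (ι-nonneg 1)))

    module _ {b d m} (root² : (ι 2 * m - b) * (ι 2 * m - b) ≈ d) where
      -- Proves an identity modulo the quadratic equation of `m`; the factor 4 clears the fractions
      -- of the completed square.
      cancel-root : ∀ {x y} → ι 4 * x - ι 4 * y ≈ (ι 2 * m - b) * (ι 2 * m - b) - d → x ≈ y
      cancel-root {x} {y} eq = *-cancelˡ-≈ (pos⇒≉0 (ι-pos 3)) (trans
        (solve 2 (λ x y → con (+ 4) :* x := con (+ 4) :* x :- con (+ 4) :* y :+ con (+ 4) :* y) refl x y)
        (trans (+-congʳ (trans eq (≈⇒-≈0 root²))) (+-identityˡ (ι 4 * y))))

    module Adjacency {m} (root≥0 : 0# ≤ ι 2 * m - n) (root² : (ι 2 * m - n) * (ι 2 * m - n) ≈ (n - ι 2) ^ 2 + ι 4 * k) where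
      -- With `n − 1` in place of `m` the square falls short of the radicand by `4 k`. The bound
      -- puts `m` above `p`, whence `a > 0`.
      n-1<m : n - ι 1 < m
      n-1<m = double-cancel-< (root-> root≥0 root² (rearrange-< (*-pos (ι-pos 3) k>0)
        (solve 2 (λ n k → con (+ 4) :* k :- con (+ 0)
          := (n :- con (+ 2)) :^ 2 :+ con (+ 4) :* k :- (con (+ 2) :* (n :- con (+ 1)) :- n) :* (con (+ 2) :* (n :- con (+ 1)) :- n)) refl n k)))

      m>0 : 0# < m
      m>0 = above-n-1⇒m>0 n-1<m

      test : ∀ {l} → l ≈ m - ι 1 → Test (ι 0) (ι 0) p k r l
      test l≈ = record
        { m    = m
        ; a    = (m - p) / m
        ; l≈   = trans l≈ (solve 2 (λ m n → m :- con (+ 1) := m :- con (+ 1) :+ con (+ 0) :* (n :- con (+ 1))) refl m n)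
        ; a>0  = ratio-pos (above-n-1⇒pos n-1<m) m>0
        ; a-eq = trans (solve-ratio (m - p) m>0)
            (solve 3 (λ m p a → m :- p := m :+ (con (+ 0) :- con (+ 1)) :* p :* (con (+ 1) :+ con (+ 0) :* a)) refl m p ((m - p) / m))
        ; l>0  = <-respʳ (sym l≈) (above-n-1⇒m-1>0 n-1<m)
        }

      -- The quadratic reads `m² = n m − (p + r − 1)`, so the numerator collapses to
      -- `p + r − 1 − p r`.
      excess-eq : ∀ {l} (l≈ : l ≈ m - ι 1) → Test.excess (test l≈) * m ≈ - ((p - ι 1) * (r - ι 1))
      excess-eq _ = trans
        (solve 5 (λ p k r a m → (p :+ k :+ r :* a :- m) :* m := (p :+ k) :* m :+ r :* (a :* m) :- m :* m) refl p k r ((m - p) / m) m)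
        (trans (+-congʳ (+-congˡ (*-congˡ (solve-ratio (m - p) m>0))))
          (sym (cancel-root root² (solve 4 (λ p k r m →
            con (+ 4) :* (:- ((p :- con (+ 1)) :* (r :- con (+ 1)))) :- con (+ 4) :* ((p :+ k) :* m :+ r :* (m :- p) :- m :* m)
            := (con (+ 2) :* m :- (p :+ (k :+ r))) :* (con (+ 2) :* m :- (p :+ (k :+ r)))
               :- ((p :+ (k :+ r) :- con (+ 2)) :^ 2 :+ con (+ 4) :* k)) refl p k r m))))

    module SignlessLaplacian {m} (root≥0 : 0# ≤ ι 2 * m - (k + ι 1))
      (root² : (ι 2 * m - (k + ι 1)) * (ι 2 * m - (k + ι 1)) ≈ (ι 2 * n - k - ι 3) ^ 2 + ι 4 * k) where
      n-1<m : n - ι 1 < m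
      n-1<m = double-cancel-< (root-> root≥0 root² (rearrange-< (*-pos (ι-pos 3) k>0)
        (solve 2 (λ n k → con (+ 4) :* k :- con (+ 0)
          := (con (+ 2) :* n :- k :- con (+ 3)) :^ 2 :+ con (+ 4) :* k
             :- (con (+ 2) :* (n :- con (+ 1)) :- (k :+ con (+ 1))) :* (con (+ 2) :* (n :- con (+ 1)) :- (k :+ con (+ 1)))) refl n k)))

      -- With `n` in place of `m` the square exceeds the radicand by `8 (p + r − 1)`. The bound is
      -- what keeps `factor` positive.
      m<n : m < n
      m<n = double-cancel-< (root-< 2n-b≥0 root² (rearrange-< (*-pos (ι-pos 7) p+r-1>0)
        (solve 3 (λ p k r → con (+ 8) :* (p :+ r :- con (+ 1)) :- con (+ 0)
          := (con (+ 2) :* (p :+ (k :+ r)) :- (k :+ con (+ 1))) :* (con (+ 2) :* (p :+ (k :+ r)) :- (k :+ con (+ 1)))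
             :- ((con (+ 2) :* (p :+ (k :+ r)) :- k :- con (+ 3)) :^ 2 :+ con (+ 4) :* k)) refl p k r)))
        where
        2n-b≥0 : 0# ≤ ι 2 * n - (k + ι 1)
        2n-b≥0 = ≤-respʳ (solve 3 (λ p k r → p :+ (k :+ r) :- con (+ 3) :+ (p :- con (+ 1) :+ (r :- con (+ 1) :+ con (+ 4)))
            := con (+ 2) :* (p :+ (k :+ r)) :- (k :+ con (+ 1))) refl p k r)
          (+-nonneg n-3≥0 (+-nonneg p-1≥0 (+-nonneg r-1≥0 (ι-nonneg 4))))

      m>0 : 0# < m
      m>0 = above-n-1⇒m>0 n-1<m

      m+p>0 : 0# < m + p
      m+p>0 = +-pos-nonneg m>0 (<⇒≤ p>0)

      test : ∀ {l} → l ≈ m + n - ι 2 → Test (ι 0) (ι 1) p k r l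
      test l≈ = record
        { m    = m
        ; a    = (m - p) / (m + p)
        ; l≈   = trans l≈ (solve 2 (λ m n → m :+ n :- con (+ 2) := m :- con (+ 1) :+ con (+ 1) :* (n :- con (+ 1))) refl m n)
        ; a>0  = ratio-pos (above-n-1⇒pos n-1<m) m+p>0
        ; a-eq = trans (solve 3 (λ m p a → a :* m := a :* (m :+ p) :- a :* p) refl m p ((m - p) / (m + p)))
            (trans (+-congʳ (solve-ratio (m - p) m+p>0))
              (solve 3 (λ m p a → m :- p :- a :* p := m :+ (con (+ 0) :- con (+ 1)) :* p :* (con (+ 1) :+ con (+ 1) :* a)) refl m p ((m - p) / (m + p))))
        ; l>0  = <-respʳ (trans (solve 2 (λ m n → m :- con (+ 1) :+ (n :- con (+ 3) :+ con (+ 2)) := m :+ n :- con (+ 2)) refl m n) (sym l≈))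
            (+-pos-nonneg (above-n-1⇒m-1>0 n-1<m) (+-nonneg n-3≥0 (ι-nonneg 2)))
        }

      factor : Carrier
      factor = ι 2 * p + n - ι 2 - m

      factor>0 : 0# < factor
      factor>0 = <-respʳ (solve 3 (λ p n m → n :- m :+ con (+ 2) :* (p :- con (+ 1)) := con (+ 2) :* p :+ n :- con (+ 2) :- m) refl p n m)
        (+-pos-nonneg (sub-pos m<n) (*-nonneg _ _ (ι-nonneg 2) p-1≥0))

      -- The quadratic reads `m² = (k + 1) m + (n − k − 2)(n − 1) + k`. As `factor` is
      -- `(n − m) + 2 (p − 1)`, hence positive, only `r = 1` brings the excess to zero.
      excess-eq : ∀ {l} (l≈ : l ≈ m + n - ι 2) → Test.excess (test l≈) * (m + p) ≈ - (factor * (r - ι 1))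
      excess-eq _ = trans
        (solve 5 (λ p k r a m → (p :+ k :+ r :* a :- m) :* (m :+ p) := (p :+ k) :* (m :+ p) :+ r :* (a :* (m :+ p)) :- m :* (m :+ p)) refl p k r ((m - p) / (m + p)) m)
        (trans (+-congʳ (+-congˡ (*-congˡ (solve-ratio (m - p) m+p>0))))
          (sym (cancel-root root² (solve 4 (λ p k r m →
            con (+ 4) :* (:- ((con (+ 2) :* p :+ (p :+ (k :+ r)) :- con (+ 2) :- m) :* (r :- con (+ 1))))
              :- con (+ 4) :* ((p :+ k) :* (m :+ p) :+ r :* (m :- p) :- m :* (m :+ p))
            := (con (+ 2) :* m :- (k :+ con (+ 1))) :* (con (+ 2) :* m :- (k :+ con (+ 1)))
               :- ((con (+ 2) :* (p :+ (k :+ r)) :- k :- con (+ 3)) :^ 2 :+ con (+ 4) :* k)) refl p k r m))))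

    module Distance {m} (root≥0 : 0# ≤ ι 2 * m - n) (root² : (ι 2 * m - n) * (ι 2 * m - n) ≈ (n + ι 2) ^ 2 - ι 4 * k - ι 8) where
      n<m : n < m
      n<m = double-cancel-< (root-> root≥0 root² (rearrange-< (*-pos (ι-pos 3) p+r-1>0)
        (solve 3 (λ p k r → con (+ 4) :* (p :+ r :- con (+ 1)) :- con (+ 0)
          := (p :+ (k :+ r) :+ con (+ 2)) :^ 2 :- con (+ 4) :* k :- con (+ 8)
             :- (con (+ 2) :* (p :+ (k :+ r)) :- (p :+ (k :+ r))) :* (con (+ 2) :* (p :+ (k :+ r)) :- (p :+ (k :+ r)))) refl p k r)))

      n-1<m : n - ι 1 < m
      n-1<m = n-1-below n<m

      m>0 : 0# < m
      m>0 = above-n-1⇒m>0 n-1<m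

      test : ∀ {l} → l ≈ m - ι 1 → Test (ι 2) (ι 0) p k r l
      test l≈ = record
        { m    = m
        ; a    = (m + p) / m
        ; l≈   = trans l≈ (solve 2 (λ m n → m :- con (+ 1) := m :- con (+ 1) :+ con (+ 0) :* (n :- con (+ 1))) refl m n)
        ; a>0  = ratio-pos (+-pos-nonneg m>0 (<⇒≤ p>0)) m>0
        ; a-eq = trans (solve-ratio (m + p) m>0)
            (solve 3 (λ m p a → m :+ p := m :+ (con (+ 2) :- con (+ 1)) :* p :* (con (+ 1) :+ con (+ 0) :* a)) refl m p ((m + p) / m))
        ; l>0  = <-respʳ (sym l≈) (above-n-1⇒m-1>0 n-1<m)
        }

      -- Now `m² = n m + (p + r − 1)`, and the numerator is `p r − (p + r − 1)`.
      excess-eq : ∀ {l} (l≈ : l ≈ m - ι 1) → Test.excess (test l≈) * m ≈ (p - ι 1) * (r - ι 1)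
      excess-eq _ = trans
        (solve 5 (λ p k r a m → (p :+ k :+ r :* a :- m) :* m := (p :+ k) :* m :+ r :* (a :* m) :- m :* m) refl p k r ((m + p) / m) m)
        (trans (+-congʳ (+-congˡ (*-congˡ (solve-ratio (m + p) m>0))))
          (sym (cancel-root root² (solve 4 (λ p k r m →
            con (+ 4) :* ((p :- con (+ 1)) :* (r :- con (+ 1))) :- con (+ 4) :* ((p :+ k) :* m :+ r :* (m :+ p) :- m :* m)
            := (con (+ 2) :* m :- (p :+ (k :+ r))) :* (con (+ 2) :* m :- (p :+ (k :+ r)))
               :- ((p :+ (k :+ r) :+ con (+ 2)) :^ 2 :- con (+ 4) :* k :- con (+ 8))) refl p k r m))))

    module DistanceSignlessLaplacian {m} (root≥0 : 0# ≤ ι 2 * m - (n + ι 1))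
      (root² : (ι 2 * m - (n + ι 1)) * (ι 2 * m - (n + ι 1)) ≈ (n + ι 3) ^ 2 - ι 8 * k - ι 16) where
      n<m : n < m
      n<m = double-cancel-< (root-> root≥0 root² (rearrange-< (*-pos (ι-pos 7) p+r-1>0)
        (solve 3 (λ p k r → con (+ 8) :* (p :+ r :- con (+ 1)) :- con (+ 0)
          := (p :+ (k :+ r) :+ con (+ 3)) :^ 2 :- con (+ 8) :* k :- con (+ 16)
             :- (con (+ 2) :* (p :+ (k :+ r)) :- (p :+ (k :+ r) :+ con (+ 1))) :* (con (+ 2) :* (p :+ (k :+ r)) :- (p :+ (k :+ r) :+ con (+ 1)))) refl p k r)))

      n-1<m : n - ι 1 < m
      n-1<m = n-1-below n<m

      m>0 : 0# < m
      m>0 = above-n-1⇒m>0 n-1<m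

      m-p>0 : 0# < m - p
      m-p>0 = above-n-1⇒pos n-1<m

      test : ∀ {l} → l ≈ m + n - ι 2 → Test (ι 2) (ι 1) p k r l
      test l≈ = record
        { m    = m
        ; a    = (m + p) / (m - p)
        ; l≈   = trans l≈ (solve 2 (λ m n → m :+ n :- con (+ 2) := m :- con (+ 1) :+ con (+ 1) :* (n :- con (+ 1))) refl m n)
        ; a>0  = ratio-pos (+-pos-nonneg m>0 (<⇒≤ p>0)) m-p>0
        ; a-eq = trans (solve 3 (λ m p a → a :* m := a :* (m :- p) :+ a :* p) refl m p ((m + p) / (m - p)))
            (trans (+-congʳ (solve-ratio (m + p) m-p>0))
              (solve 3 (λ m p a → m :+ p :+ a :* p := m :+ (con (+ 2) :- con (+ 1)) :* p :* (con (+ 1) :+ con (+ 1) :* a)) refl m p ((m + p) / (m - p))))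
        ; l>0  = <-respʳ (trans (solve 2 (λ m n → m :- con (+ 1) :+ (n :- con (+ 3) :+ con (+ 2)) := m :+ n :- con (+ 2)) refl m n) (sym l≈))
            (+-pos-nonneg (above-n-1⇒m-1>0 n-1<m) (+-nonneg n-3≥0 (ι-nonneg 2)))
        }

      factor : Carrier
      factor = m + n - ι 2 * p - ι 2 - ι 2 * k

      factor>0 : 0# < factor
      factor>0 = <-respʳ (solve 4 (λ p k r m → m :- (p :+ (k :+ r)) :+ con (+ 2) :* (r :- con (+ 1)) := m :+ (p :+ (k :+ r)) :- con (+ 2) :* p :- con (+ 2) :- con (+ 2) :* k) refl p k r m)
        (+-pos-nonneg (sub-pos n<m) (*-nonneg _ _ (ι-nonneg 2) r-1≥0))

      -- The quadratic reads `m² = (n + 1) m + n − 2 k − 2`. As `factor` is `(m − n) + 2 (r − 1)`,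
      -- hence positive, only `p = 1` brings the excess to zero.
      excess-eq : ∀ {l} (l≈ : l ≈ m + n - ι 2) → Test.excess (test l≈) * (m - p) ≈ factor * (p - ι 1)
      excess-eq _ = trans
        (solve 5 (λ p k r a m → (p :+ k :+ r :* a :- m) :* (m :- p) := (p :+ k) :* (m :- p) :+ r :* (a :* (m :- p)) :- m :* (m :- p)) refl p k r ((m + p) / (m - p)) m)
        (trans (+-congʳ (+-congˡ (*-congˡ (solve-ratio (m + p) m-p>0))))
          (sym (cancel-root root² (solve 4 (λ p k r m →
            con (+ 4) :* ((m :+ (p :+ (k :+ r)) :- con (+ 2) :* p :- con (+ 2) :- con (+ 2) :* k) :* (p :- con (+ 1)))
              :- con (+ 4) :* ((p :+ k) :* (m :- p) :+ r :* (m :+ p) :- m :* (m :- p))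
            := (con (+ 2) :* m :- (p :+ (k :+ r) :+ con (+ 1))) :* (con (+ 2) :* m :- (p :+ (k :+ r) :+ con (+ 1)))
               :- ((p :+ (k :+ r) :+ con (+ 3)) :^ 2 :- con (+ 8) :* k :- con (+ 16))) refl p k r m))))

open Combinatorics

-- The four matrices as weighted row sums

module Models (ℝ : CompleteOrderedField) where
  open OrderedField ℝ
  open LinearAlgebra ℝ
  open RadiusBounds ℝ
  open TestNumbers ℝ
  open import Relation.Binary.Reasoning.Setoid setoid

  -- c = 0 gives the matrix with entries w, and c = 1 adds the diagonal of its row sums.
  weightedSum : ∀ {n} → Carrier → (Fin n → Fin n → ℕ) → Vector Carrier n → Vector Carrier n
  weightedSum c w x i = sum (λ j → ι (w i j) * (x j + c * x i))

  -- A common interface for the four matrices: the action serves the row estimates, and entrywise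
  -- domination gives nonnegativity and the positive entries used in the equality cases.
  record Represents {n} (M : Matrix n) (c : Carrier) (w : Fin n → Fin n → ℕ) : Set where
    field
      acts      : ∀ x i → (M ⊛ x) i ≈ weightedSum c w x i
      dominates : ∀ i j → ι (w i j) ≤ M i j

    nonneg : NonNegative M
    nonneg i j = ≤-trans (ι-nonneg (w i j)) (dominates i j)

    positive : ∀ i j → 1 Nat.≤ w i j → 0# < M i j
    positive i j 1≤w = <-≤-trans (<-≤-trans (ι-pos 0) (ι-mono-≤ 1≤w)) (dominates i j)

  represents-plain : ∀ {n} {M : Matrix n} {w} → (∀ i j → M i j ≈ ι (w i j)) → Represents M (ι 0) w
  represents-plain {M = M} {w} M≈w = record
    { acts = λ x i → sum-cong-≋ (λ j → trans (*-congʳ (M≈w i j))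
        (solve 3 (λ w x y → w :* x := w :* (x :+ con (+ 0) :* y)) refl (ι (w i j)) (x j) (x i)))
    ; dominates = λ i j → ≤-reflexive (sym (M≈w i j))
    }

  diag-nonneg : ∀ {n} (d : Vector Carrier n) → (∀ i → 0# ≤ d i) → NonNegative (diag d)
  diag-nonneg d d≥0 i j with does (i ≟ j)
  ... | true  = d≥0 i
  ... | false = ≤-refl

  represents-diag : ∀ {n} {M : Matrix n} {w} {d : Vector Carrier n} → (∀ i j → M i j ≈ ι (w i j)) →
                    (∀ i → d i ≈ sum (λ j → ι (w i j))) → Represents (diag d +ₘ M) (ι 1) w
  represents-diag {M = M} {w} {d} M≈w d≈ = record
    { acts = λ x i → begin
        sum (λ j → (diag d i j + M i j) * x j)
          ≈⟨ sum-cong-≋ (λ j → trans (*-congʳ (+-congˡ (M≈w i j)))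
               (solve 3 (λ d w x → (d :+ w) :* x := d :* x :+ con (+ 1) :* (w :* x)) refl (diag d i j) (ι (w i j)) (x j))) ⟩
        sum (λ j → diag d i j * x j + ι 1 * (ι (w i j) * x j))
          ≈⟨ sum-linear (ι 1) (λ j → diag d i j * x j) (λ j → ι (w i j) * x j) ⟩
        (diag d ⊛ x) i + ι 1 * sum (λ j → ι (w i j) * x j)
          ≈⟨ +-congʳ (⊛-diag d x i) ⟩
        d i * x i + ι 1 * sum (λ j → ι (w i j) * x j)
          ≈⟨ solve 3 (λ d x s → d :* x :+ con (+ 1) :* s := s :+ x :* d) refl (d i) (x i) (sum (λ j → ι (w i j) * x j)) ⟩
        sum (λ j → ι (w i j) * x j) + x i * d i
          ≈⟨ +-congˡ (*-congˡ (d≈ i)) ⟩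
        sum (λ j → ι (w i j) * x j) + x i * sum (λ j → ι (w i j))
          ≈⟨ sum-linear (x i) (λ j → ι (w i j) * x j) (λ j → ι (w i j)) ⟨
        sum (λ j → ι (w i j) * x j + x i * ι (w i j))
          ≈⟨ sum-cong-≋ (λ j → solve 3 (λ w x y → w :* x :+ y :* w := w :* (x :+ con (+ 1) :* y)) refl (ι (w i j)) (x j) (x i)) ⟩
        weightedSum (ι 1) w x i ∎
    ; dominates = λ i j → ≤-respˡ (+-identityˡ (ι (w i j))) (+-mono-≤
        (diag-nonneg d (λ i → ≤-respʳ (sym (d≈ i)) (sum-nonneg (λ j → ι-nonneg (w i j)))) i j)
        (≤-reflexive (sym (M≈w i j))))
    }

  adjacency≈ : ∀ {n} (G : Digraph n) i j → adjacency G i j ≈ ι (arcCount G i j)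
  adjacency≈ G i j with arc G i j
  ... | true  = sym (+-identityʳ 1#)
  ... | false = refl

  ι-∣tabulate∣ : ∀ {n} (b : Fin n → Bool) → ι ∣ tabulate b ∣ ≈ sum (λ j → ι (if b j then 1 else 0))
  ι-∣tabulate∣ {zero}  b = refl
  ι-∣tabulate∣ {suc n} b with b zero
  ... | true  = +-cong (sym (+-identityʳ 1#)) (ι-∣tabulate∣ (b ∘ suc))
  ... | false = trans (ι-∣tabulate∣ (b ∘ suc)) (sym (+-identityˡ _))

  adjacency-represents : ∀ {n} (G : Digraph n) → Represents (adjacency G) (ι 0) (arcCount G)
  adjacency-represents G = represents-plain (adjacency≈ G)

  signlessLaplacian-represents : ∀ {n} (G : Digraph n) → Represents (signlessLaplacian G) (ι 1) (arcCount G)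
  signlessLaplacian-represents G = represents-diag (adjacency≈ G) (λ i → ι-∣tabulate∣ (arc G i))

  distance-represents : ∀ {n} (d : Fin n → Fin n → ℕ) → Represents (distance d) (ι 0) d
  distance-represents d = represents-plain (λ i j → refl)

  distanceSignlessLaplacian-represents : ∀ {n} (d : Fin n → Fin n → ℕ) → Represents (distanceSignlessLaplacian d) (ι 1) d
  distanceSignlessLaplacian-represents d = represents-diag (λ i j → refl) (λ i → refl)

  module _ {n} {c : Carrier} (c≥0 : 0# ≤ c) {x : Vector Carrier n} (x>0 : Positive x) where

    bracket>0 : ∀ i j → 0# < x j + c * x i
    bracket>0 i j = +-pos-nonneg (x>0 j) (*-nonneg _ _ c≥0 (<⇒≤ (x>0 i)))

    module _ {v w : Fin n → Fin n → ℕ} (v≤w : ∀ i j → v i j Nat.≤ w i j) where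

      term-≤ : ∀ i j → ι (v i j) * (x j + c * x i) ≤ ι (w i j) * (x j + c * x i)
      term-≤ i j = *-monoˡ-≤ (<⇒≤ (bracket>0 i j)) (ι-mono-≤ (v≤w i j))

      weightedSum-mono : ∀ i → weightedSum c v x i ≤ weightedSum c w x i
      weightedSum-mono i = sum-mono-≤ (term-≤ i)

      -- Every bracket is positive, so one differing weight would make its row sum strictly smaller.
      -- This is how equality of the radii determines the digraph.
      weightedSum-≈⇒≡ : (∀ i → weightedSum c v x i ≈ weightedSum c w x i) → ∀ i j → v i j ≡ w i j
      weightedSum-≈⇒≡ same i j with v i j Nat.≟ w i j
      ... | yes v≡w = v≡w
      ... | no  v≢w = ⊥-elim (<⇒≉ (*-monoˡ-< (bracket>0 i j) (ι-mono-< (ℕₚ.≤∧≢⇒< (v≤w i j) v≢w)))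
                                 (sum-≈⇒≈ (term-≤ i) (same i) j))

  sum-colours : ∀ {n} (f : Fin n → Colour) (F : Colour → Carrier) →
                sum (λ j → F (f j)) ≈ ι (count P f) * F P + (ι (count S f) * F S + ι (count R f) * F R)
  sum-colours {zero}  f F = solve 3 (λ x y z → con (+ 0) := con (+ 0) :* x :+ (con (+ 0) :* y :+ con (+ 0) :* z)) refl (F P) (F S) (F R)
  sum-colours {suc n} f F = trans (+-cong (head (f zero)) (sum-colours (f ∘ suc) F)) (trans
    (solve 9 (λ x y z a b c a′ b′ c′ → a :* x :+ (b :* y :+ c :* z) :+ (a′ :* x :+ (b′ :* y :+ c′ :* z))
        := (a :+ a′) :* x :+ ((b :+ b′) :* y :+ (c :+ c′) :* z)) refl
      (F P) (F S) (F R) (ι (tally P (f zero))) (ι (tally S (f zero))) (ι (tally R (f zero)))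
      (ι (count P (f ∘ suc))) (ι (count S (f ∘ suc))) (ι (count R (f ∘ suc))))
    (sym (+-cong (*-congʳ (ι-homo-+ (tally P (f zero)) (count P (f ∘ suc))))
      (+-cong (*-congʳ (ι-homo-+ (tally S (f zero)) (count S (f ∘ suc)))) (*-congʳ (ι-homo-+ (tally R (f zero)) (count R (f ∘ suc))))))))
    where
    head : ∀ d → F d ≈ ι (tally P d) * F P + (ι (tally S d) * F S + ι (tally R d) * F R)
    head P = solve 3 (λ x y z → x := con (+ 1) :* x :+ (con (+ 0) :* y :+ con (+ 0) :* z)) refl (F P) (F S) (F R)
    head S = solve 3 (λ x y z → y := con (+ 0) :* x :+ (con (+ 1) :* y :+ con (+ 0) :* z)) refl (F P) (F S) (F R)
    head R = solve 3 (λ x y z → z := con (+ 0) :* x :+ (con (+ 0) :* y :+ con (+ 1) :* z)) refl (F P) (F S) (F R)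

  blockWeight-diagonal : ∀ e d → blockWeight e d d ≡ 1
  blockWeight-diagonal e P = ≡.refl
  blockWeight-diagonal e S = ≡.refl
  blockWeight-diagonal e R = ≡.refl

  -- With the zero diagonal filled by ones the entry depends on the two colours alone, so that row
  -- sums split by classes.
  weight+diag : ∀ {n} e (f : Fin n → Colour) i j →
                ι (weight e f i j) + diag (λ _ → ι 1) i j ≈ ι (blockWeight e (f i) (f j))
  weight+diag e f i j with i ≟ j
  ... | yes ≡.refl = trans (+-identityˡ (ι 1)) (reflexive (≡.cong ι (≡.sym (blockWeight-diagonal e (f i)))))
  ... | no  _      = +-identityʳ _

  weightedSum-weight : ∀ {n} c e (f : Fin n → Colour) (X : Colour → Carrier) i →
    weightedSum c (weight e f) (X ∘ f) i ≈
    ι (count P f) * (ι (blockWeight e (f i) P) * (X P + c * X (f i))) +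
      (ι (count S f) * (ι (blockWeight e (f i) S) * (X S + c * X (f i))) +
       ι (count R f) * (ι (blockWeight e (f i) R) * (X R + c * X (f i)))) - (X (f i) + c * X (f i))
  weightedSum-weight c e f X i = begin
    Σw
      ≈⟨ solve 2 (λ s t → s := s :+ con (+ 1) :* (con (+ 1) :* t) :- t) refl Σw (t i) ⟩
    Σw + ι 1 * (ι 1 * t i) - t i
      ≈⟨ +-congʳ (+-congˡ (*-congˡ (sym (⊛-diag (λ _ → ι 1) t i)))) ⟩
    Σw + ι 1 * (diag (λ _ → ι 1) ⊛ t) i - t i
      ≈⟨ +-congʳ (sum-linear (ι 1) (λ j → ι (weight e f i j) * t j) (λ j → diag (λ _ → ι 1) i j * t j)) ⟨
    sum (λ j → ι (weight e f i j) * t j + ι 1 * (diag (λ _ → ι 1) i j * t j)) - t i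
      ≈⟨ +-congʳ (sum-cong-≋ (λ j → trans
           (solve 3 (λ w d t → w :* t :+ con (+ 1) :* (d :* t) := (w :+ d) :* t) refl (ι (weight e f i j)) (diag (λ _ → ι 1) i j) (t j))
           (*-congʳ (weight+diag e f i j)))) ⟩
    sum (λ j → ι (blockWeight e (f i) (f j)) * t j) - t i
      ≈⟨ +-congʳ (sum-colours f (λ d → ι (blockWeight e (f i) d) * (X d + c * X (f i)))) ⟩
    _ ∎
    where
    t : Vector Carrier _
    t j = X (f j) + c * X (f i)
    Σw : Carrier
    Σw = sum (λ j → ι (weight e f i j) * t j)

  testVector : Carrier → Colour → Carrier
  testVector a P = ι 1
  testVector a S = ι 1
  testVector a R = a

  module TestRows {n} e {c p k r l} (c≥0 : 0# ≤ c) (test : Test (ι e) c (ι p) (ι k) (ι r) l)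
                  (f : Fin n → Colour) (sizes : HasSizes p k r f) where
    open Test test public

    x : Vector Carrier n
    x = testVector a ∘ f

    testVector>0 : ∀ d → 0# < testVector a d
    testVector>0 P = ι-pos 0
    testVector>0 S = ι-pos 0
    testVector>0 R = a>0

    x>0 : Positive x
    x>0 i = testVector>0 (f i)

    rows : ∀ i → weightedSum c (weight e f) x i ≈ l * x i + excess
    rows i = trans (weightedSum-weight c e f (testVector a) i)
      (trans (+-congʳ (+-cong (*-congʳ (size≈ P)) (+-cong (*-congʳ (size≈ S)) (*-congʳ (size≈ R))))) (row (f i)))
      where
      size≈ : ∀ d → ι (count d f) ≈ ι (size p k r d)
      size≈ d = reflexive (≡.cong ι (sizes d))
      row : ∀ d →
        ι p * (ι (blockWeight e d P) * (ι 1 + c * testVector a d)) +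
          (ι k * (ι (blockWeight e d S) * (ι 1 + c * testVector a d)) +
           ι r * (ι (blockWeight e d R) * (a + c * testVector a d))) - (testVector a d + c * testVector a d)
        ≈ l * testVector a d + excess
      row P = row-1
      row S = row-1
      row R = row-a

    module _ {M : Matrix n} {w} (represents : Represents M c w) (i₀ : Fin n)
             {ρ} (radius : IsSpectralRadius M ρ) where
      open Represents represents

      module Above (w≤ : ∀ i j → w i j Nat.≤ weight e f i j) (excess≤0 : excess ≤ 0#) where

        rows-≤ : ∀ i → l * x i + excess ≤ l * x i
        rows-≤ i = ≤-respʳ (+-identityʳ (l * x i)) (+-mono-≤ ≤-refl excess≤0)

        Mx≤ : ∀ i → (M ⊛ x) i ≤ l * x i + excess
        Mx≤ i = ≤-respˡ (sym (acts x i)) (≤-respʳ (rows i) (weightedSum-mono c≥0 x>0 w≤ i))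

        Mx≤lx : ∀ i → (M ⊛ x) i ≤ l * x i
        Mx≤lx i = ≤-trans (Mx≤ i) (rows-≤ i)

        radius-≤l : ρ ≤ l
        radius-≤l = RadiusAbove.radius-≤ i₀ nonneg radius l>0 x>0 Mx≤lx

        -- In the chain `M x ≤ l x + excess ≤ l x` the ends agree, so both steps are equalities: the
        -- first gives the entries, the second the excess.
        radius-≈l : (∀ i j → Star (λ i j → 0# < M i j) i j) → ρ ≈ l →
                    (∀ i j → w i j ≡ weight e f i j) × excess ≈ 0#
        radius-≈l connected ρ≈l =
          weightedSum-≈⇒≡ c≥0 x>0 w≤ (λ i → trans (sym (acts x i)) (trans (Mx≈lx i) (trans (sym (tight i)) (sym (rows i))))) ,
          trans (solve 2 (λ y z → z := y :+ z :- y) refl (l * x i₀) excess) (≈⇒-≈0 (tight i₀))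
          where
          Mx≈lx : ∀ i → (M ⊛ x) i ≈ l * x i
          Mx≈lx = RadiusAbove.radius-≈ i₀ nonneg radius l>0 x>0 Mx≤lx connected ρ≈l
          tight : ∀ i → l * x i + excess ≈ l * x i
          tight i = antisym (rows-≤ i) (≤-respˡ (Mx≈lx i) (Mx≤ i))

      module Below (w≥ : ∀ i j → weight e f i j Nat.≤ w i j) (excess≥0 : 0# ≤ excess) where

        rows-≥ : ∀ i → l * x i ≤ l * x i + excess
        rows-≥ i = ≤-respˡ (+-identityʳ (l * x i)) (+-mono-≤ ≤-refl excess≥0)

        Mx≥ : ∀ i → l * x i + excess ≤ (M ⊛ x) i
        Mx≥ i = ≤-respʳ (sym (acts x i)) (≤-respˡ (rows i) (weightedSum-mono c≥0 x>0 w≥ i))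

        Mx≥lx : ∀ i → l * x i ≤ (M ⊛ x) i
        Mx≥lx i = ≤-trans (rows-≥ i) (Mx≥ i)

        radius-≥l : l ≤ ρ
        radius-≥l = RadiusBelow.radius-≥ i₀ nonneg radius (<⇒≤ l>0) x>0 Mx≥lx

        radius-≈l : (∀ i j → ¬ i ≡ j → 0# < M i j) → ρ ≈ l →
                    (∀ i j → weight e f i j ≡ w i j) × excess ≈ 0#
        radius-≈l M>0 ρ≈l =
          weightedSum-≈⇒≡ c≥0 x>0 w≥ (λ i → trans (rows i) (trans (tight i) (trans (sym (Mx≈lx i)) (acts x i)))) ,
          trans (solve 2 (λ y z → z := y :+ z :- y) refl (l * x i₀) excess) (≈⇒-≈0 (tight i₀))
          where
          Mx≈lx : ∀ i → (M ⊛ x) i ≈ l * x i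
          Mx≈lx = RadiusBelow.radius-≈ i₀ nonneg radius (<⇒≤ l>0) x>0 Mx≥lx M>0 ρ≈l
          tight : ∀ i → l * x i + excess ≈ l * x i
          tight i = antisym (≤-respʳ (Mx≈lx i) (Mx≥ i)) (rows-≥ i)

-- The four bounds and their equality cases

module Assembly (ℝ : CompleteOrderedField) where
  open OrderedField ℝ
  open LinearAlgebra ℝ
  open TestNumbers ℝ
  open Models ℝ
  open import Relation.Binary.Reasoning.Setoid setoid

  module Bounds {n k} (1≤k : 1 Nat.≤ k) (k+2≤n : k Nat.+ 2 Nat.≤ n) (G : Digraph n) (G∈Ω : G ∈Ω[ k ]) where

    i₀ : Fin n
    i₀ = fromℕ< (ℕₚ.≤-trans (ℕₚ.≤-trans 1≤k (ℕₚ.m≤m+n k 2)) k+2≤n)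

    cut : Cut G k
    cut = connectivity⇒cut k+2≤n G∈Ω

    f₀ : Fin n → Colour
    f₀ = Cut.colour cut

    n≡ : n ≡ count P f₀ Nat.+ (k Nat.+ count R f₀)
    n≡ = ≡.trans (≡.sym (count-total f₀)) (≡.cong (λ s → count P f₀ Nat.+ (s Nat.+ count R f₀)) (Cut.S-size cut))

    sizes₀ : HasSizes (count P f₀) k (count R f₀) f₀
    sizes₀ P = ≡.refl
    sizes₀ S = Cut.S-size cut
    sizes₀ R = ≡.refl

    -- Quantified over all sizes with a fixed `l`: the bound uses the sizes of the given cut, and
    -- the converse of the equality clause those of an arbitrary extremal model.
    Tests : (Carrier → Set) → ℕ → Carrier → Carrier → (ℕ → ℕ → Set) → Set
    Tests Sign e c l E = ∀ p r → n ≡ p Nat.+ (k Nat.+ r) → 1 Nat.≤ p → 1 Nat.≤ r →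
      Σ[ test ∈ Test (ι e) c (ι p) (ι k) (ι r) l ] (Sign (Test.excess test) × (Test.excess test ≈ 0# ⇔ E p r))

    upper : ∀ {c l E M ρ} → 0# ≤ c → Represents M c (arcCount G) → Tests (_≤ 0#) 0 c l E →
            IsSpectralRadius M ρ → ρ ≤ l × (ρ ≈ l ⇔ ExtremalModel G k E)
    upper {c} {l} {E} {M} {ρ} c≥0 represents tests radius = ρ≤l , mk⇔ extremal attained
      where
      test₀ = tests (count P f₀) (count R f₀) n≡ (Cut.P-size cut) (Cut.R-size cut)
      module T₀ = TestRows 0 c≥0 (proj₁ test₀) f₀ sizes₀
      module A₀ = T₀.Above represents i₀ radius (arcCount-≤ cut) (proj₁ (proj₂ test₀))

      ρ≤l : ρ ≤ l
      ρ≤l = A₀.radius-≤l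

      M-connected : ∀ i j → Star (λ i j → 0# < M i j) i j
      M-connected i j = Star.map (λ {u} {v} u→v → Represents.positive represents u v (arcCount-pos {G = G} u→v))
        (_∈Ω[_].stronglyConnected G∈Ω i j)

      extremal : ρ ≈ l → ExtremalModel G k E
      extremal ρ≈l =
        let (same , excess≈0) = A₀.radius-≈l M-connected ρ≈l
        in count P f₀ , count R f₀ , f₀ , n≡ , Cut.P-size cut , Cut.R-size cut , sizes₀ ,
           arcCount⇒model {G = G} same , Equivalence.to (proj₂ (proj₂ test₀)) excess≈0

      -- For an extremal model the weights agree and the excess vanishes, so the comparison also
      -- runs in the opposite direction.
      attained : ExtremalModel G k E → ρ ≈ l
      attained (p , r , f , n≡ , 1≤p , 1≤r , sizes , model , ext) = antisym ρ≤l
        (TestRows.Below.radius-≥l 0 c≥0 (proj₁ test) f sizes represents i₀ radius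
          (λ i j → ℕₚ.≤-reflexive (≡.sym (model⇒arcCount {G = G} model i j)))
          (≤-reflexive (sym (Equivalence.from (proj₂ (proj₂ test)) ext))))
        where test = tests p r n≡ 1≤p 1≤r

    lower : ∀ {c l E M ρ d} → 0# ≤ c → IsDistance G d → Represents M c d → Tests (0# ≤_) 2 c l E →
            IsSpectralRadius M ρ → l ≤ ρ × (ρ ≈ l ⇔ ExtremalModel G k E)
    lower {c} {l} {E} {M} {ρ} {d} c≥0 isDistance represents tests radius = l≤ρ , mk⇔ extremal attained
      where
      open Distances isDistance
      test₀ = tests (count P f₀) (count R f₀) n≡ (Cut.P-size cut) (Cut.R-size cut)
      module T₀ = TestRows 2 c≥0 (proj₁ test₀) f₀ sizes₀
      module B₀ = T₀.Below represents i₀ radius (weight-≤-distance cut) (proj₁ (proj₂ test₀))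

      l≤ρ : l ≤ ρ
      l≤ρ = B₀.radius-≥l

      extremal : ρ ≈ l → ExtremalModel G k E
      extremal ρ≈l =
        let (same , excess≈0) = B₀.radius-≈l (λ i j i≢j → Represents.positive represents i j (distance-pos i≢j)) ρ≈l
        in count P f₀ , count R f₀ , f₀ , n≡ , Cut.P-size cut , Cut.R-size cut , sizes₀ ,
           distance⇒model (λ i j → ≡.sym (same i j)) , Equivalence.to (proj₂ (proj₂ test₀)) excess≈0

      attained : ExtremalModel G k E → ρ ≈ l
      attained (p , r , f , n≡ , 1≤p , 1≤r , sizes , model , ext) = antisym
        (TestRows.Above.radius-≤l 2 c≥0 (proj₁ test) f sizes represents i₀ radius
          -- `1 ≤ k` supplies the vertex of S through which R reaches P in two steps.
          (λ i j → ℕₚ.≤-reflexive (model⇒distance (≡.subst (1 Nat.≤_) (≡.sym (sizes S)) 1≤k) model i j))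
          (≤-reflexive (Equivalence.from (proj₂ (proj₂ test)) ext)))
        l≤ρ
        where test = tests p r n≡ 1≤p 1≤r

    negative-excess : ∀ {x den q} → 0# < den → 0# ≤ q → x * den ≈ - q → x ≤ 0# × (x ≈ 0# ⇔ q ≈ 0#)
    negative-excess {x} {den} {q} den>0 q≥0 eq =
      *-cancelˡ-≤ den>0 (≤-respˡ (sym (trans (*-comm den x) eq)) (rearrange-≤ q≥0
        (solve 2 (λ q d → q :- con (+ 0) := d :* con (+ 0) :- (:- q)) refl q den))) ,
      mk⇔ (λ x≈0 → trans (solve 1 (λ q → q := :- (:- q)) refl q)
             (trans (-‿cong (trans (sym eq) (trans (*-congʳ x≈0) (zeroˡ den)))) (solve 0 (:- con (+ 0) := con (+ 0)) refl)))
          (λ q≈0 → *-cancelˡ-0 (pos⇒≉0 den>0) (trans (*-comm den x) (trans eq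
             (trans (-‿cong q≈0) (solve 0 (:- con (+ 0) := con (+ 0)) refl)))))

    positive-excess : ∀ {x den q} → 0# < den → 0# ≤ q → x * den ≈ q → 0# ≤ x × (x ≈ 0# ⇔ q ≈ 0#)
    positive-excess {x} {den} {q} den>0 q≥0 eq =
      *-cancelˡ-≤ den>0 (≤-respˡ (sym (zeroʳ den)) (≤-respʳ (trans (sym eq) (*-comm x den)) q≥0)) ,
      mk⇔ (λ x≈0 → trans (sym eq) (trans (*-congʳ x≈0) (zeroˡ den)))
          (λ q≈0 → *-cancelˡ-0 (pos⇒≉0 den>0) (trans (*-comm den x) (trans eq q≈0)))

    ι-1≥0 : ∀ {p} → 1 Nat.≤ p → 0# ≤ ι p - ι 1
    ι-1≥0 1≤p = sub-nonneg (ι-mono-≤ 1≤p)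

    ι-1≈0⇔ : ∀ {p} → 1 Nat.≤ p → (ι p - ι 1 ≈ 0# ⇔ p ≡ 1)
    ι-1≈0⇔ {p} 1≤p = mk⇔ forward λ { ≡.refl → -‿inverseʳ (ι 1) }
      where
      forward : ι p - ι 1 ≈ 0# → p ≡ 1
      forward eq with p Nat.≟ 1
      ... | yes p≡1 = p≡1
      ... | no  p≢1 = ⊥-elim (<⇒≉ (sub-pos (ι-mono-< (ℕₚ.≤∧≢⇒< 1≤p (p≢1 ∘ ≡.sym)))) (sym eq))

    product≈0⇔ : ∀ {x y} → (x * y ≈ 0#) ⇔ (x ≈ 0# ⊎ y ≈ 0#)
    product≈0⇔ {x} {y} = mk⇔ forward
      [ (λ x≈0 → trans (*-congʳ x≈0) (zeroˡ y)) , (λ y≈0 → trans (*-congˡ y≈0) (zeroʳ x)) ]′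
      where
      forward : x * y ≈ 0# → x ≈ 0# ⊎ y ≈ 0#
      forward xy≈0 with x ≈? 0#
      ... | yes x≈0 = inj₁ x≈0
      ... | no  x≉0 = inj₂ (*-cancelˡ-0 x≉0 xy≈0)

    corner⇔ : ∀ {p r} → 1 Nat.≤ p → 1 Nat.≤ r → ((ι p - ι 1) * (ι r - ι 1) ≈ 0# ⇔ (p ≡ 1 ⊎ r ≡ 1))
    corner⇔ 1≤p 1≤r = mk⇔
      (λ eq → Sum.map (Equivalence.to (ι-1≈0⇔ 1≤p)) (Equivalence.to (ι-1≈0⇔ 1≤r)) (Equivalence.to product≈0⇔ eq))
      (λ ext → Equivalence.from product≈0⇔ (Sum.map (Equivalence.from (ι-1≈0⇔ 1≤p)) (Equivalence.from (ι-1≈0⇔ 1≤r)) ext))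

    factor⇔ : ∀ {x p} → 0# < x → 1 Nat.≤ p → (x * (ι p - ι 1) ≈ 0# ⇔ p ≡ 1)
    factor⇔ x>0 1≤p = mk⇔
      (λ eq → Equivalence.to (ι-1≈0⇔ 1≤p) (*-cancelˡ-0 (pos⇒≉0 x>0) eq))
      (λ p≡1 → trans (*-congˡ (Equivalence.from (ι-1≈0⇔ 1≤p) p≡1)) (zeroʳ _))

    ι-split : ∀ p r → n ≡ p Nat.+ (k Nat.+ r) → ι n ≈ ι p + (ι k + ι r)
    ι-split p r n≡ = trans (reflexive (≡.cong ι n≡)) (trans (ι-homo-+ p (k Nat.+ r)) (+-congˡ (ι-homo-+ k r)))

    half : ∀ x → ι 2 * (x / ι 2) ≈ x
    half x = trans (*-comm (ι 2) (x / ι 2)) (solve-ratio x (ι-pos 1))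

    square-cong : ∀ {x y} → x ≈ y → x ^ 2 ≈ y ^ 2
    square-cong x≈y = *-cong x≈y (*-congʳ x≈y)

    -- Undoes the quadratic formula for `m = l + 1`, identifying the given root `s` with `2 m − n`.
    shifted-root : ∀ s {n′} → ι n ≈ n′ → ι 2 * ((ι n - ι 2 + s) / ι 2 + ι 1) - n′ ≈ s
    shifted-root s {n′} n≈ = begin
      ι 2 * (l + ι 1) - n′             ≈⟨ solve 2 (λ l n → con (+ 2) :* (l :+ con (+ 1)) :- n := con (+ 2) :* l :+ con (+ 2) :- n) refl l n′ ⟩
      ι 2 * l + ι 2 - n′               ≈⟨ +-congˡ (-‿cong (sym n≈)) ⟩
      ι 2 * l + ι 2 - ι n              ≈⟨ +-congʳ (+-congʳ (half (ι n - ι 2 + s))) ⟩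
      (ι n - ι 2 + s) + ι 2 - ι n      ≈⟨ solve 2 (λ n s → n :- con (+ 2) :+ s :+ con (+ 2) :- n := s) refl (ι n) s ⟩
      s                                ∎
      where
      l : Carrier
      l = (ι n - ι 2 + s) / ι 2

    root-≥0 : ∀ {x d s} → x ≈ s → IsSqrt d s → 0# ≤ x
    root-≥0 x≈s (s≥0 , _) = ≤-respʳ (sym x≈s) s≥0

    root-square : ∀ {x d d′ s} → x ≈ s → IsSqrt d s → d ≈ d′ → x * x ≈ d′
    root-square x≈s (_ , s²) d≈d′ = trans (*-cong x≈s x≈s) (trans s² d≈d′)

    k≥1 : ι 1 ≤ ι k
    k≥1 = ι-mono-≤ 1≤k

    adjacency-tests : ∀ {s} → IsSqrt ((ι n - ι 2) ^ 2 + ι 4 * ι k) s →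
                      Tests (_≤ 0#) 0 (ι 0) ((ι n - ι 2 + s) / ι 2) (λ p r → p ≡ 1 ⊎ r ≡ 1)
    adjacency-tests {s} root p r n≡ 1≤p 1≤r = test l≈ , proj₁ sign , corner⇔ 1≤p 1≤r ⇔-∘ proj₂ sign
      where
      l = (ι n - ι 2 + s) / ι 2
      n′ = ι p + (ι k + ι r)
      n≈ : ι n ≈ n′
      n≈ = ι-split p r n≡
      m≈s : ι 2 * (l + ι 1) - n′ ≈ s
      m≈s = shifted-root s n≈
      l≈ : l ≈ l + ι 1 - ι 1
      l≈ = solve 1 (λ l → l := l :+ con (+ 1) :- con (+ 1)) refl l
      open Parameters (ι-mono-≤ 1≤p) k≥1 (ι-mono-≤ 1≤r) using (module Adjacency)
      open Adjacency (root-≥0 m≈s root)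
        (root-square m≈s root (+-congʳ (square-cong (+-congʳ n≈))))
      sign = negative-excess m>0 (*-nonneg _ _ (ι-1≥0 1≤p) (ι-1≥0 1≤r)) (excess-eq l≈)

    signlessLaplacian-tests : ∀ {s} → IsSqrt ((ι 2 * ι n - ι k - ι 3) ^ 2 + ι 4 * ι k) s →
                              Tests (_≤ 0#) 0 (ι 1) ((ι 2 * ι n + ι k - ι 3 + s) / ι 2) (λ p r → r ≡ 1)
    signlessLaplacian-tests {s} root p r n≡ 1≤p 1≤r = test l≈ , proj₁ sign , factor⇔ factor>0 1≤r ⇔-∘ proj₂ sign
      where
      l = (ι 2 * ι n + ι k - ι 3 + s) / ι 2
      n′ = ι p + (ι k + ι r)
      n≈ : ι n ≈ n′
      n≈ = ι-split p r n≡
      -- Here `m = l + 2 − n`, as the diagonal of row sums, `c = 1`, shifts the eigenvalue by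
      -- `n − 1`.
      m≈s : ι 2 * (l - n′ + ι 2) - (ι k + ι 1) ≈ s
      m≈s = begin
        ι 2 * (l - n′ + ι 2) - (ι k + ι 1)
          ≈⟨ solve 3 (λ l n k → con (+ 2) :* (l :- n :+ con (+ 2)) :- (k :+ con (+ 1)) := con (+ 2) :* l :+ (con (+ 3) :- k) :- con (+ 2) :* n) refl l n′ (ι k) ⟩
        ι 2 * l + (ι 3 - ι k) - ι 2 * n′
          ≈⟨ +-cong (+-congʳ (half _)) (-‿cong (*-congˡ (sym n≈))) ⟩
        (ι 2 * ι n + ι k - ι 3 + s) + (ι 3 - ι k) - ι 2 * ι n
          ≈⟨ solve 3 (λ n k s → con (+ 2) :* n :+ k :- con (+ 3) :+ s :+ (con (+ 3) :- k) :- con (+ 2) :* n := s) refl (ι n) (ι k) s ⟩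
        s ∎
      l≈ : l ≈ l - n′ + ι 2 + n′ - ι 2
      l≈ = solve 2 (λ l n → l := l :- n :+ con (+ 2) :+ n :- con (+ 2)) refl l n′
      open Parameters (ι-mono-≤ 1≤p) k≥1 (ι-mono-≤ 1≤r) using (module SignlessLaplacian)
      open SignlessLaplacian (root-≥0 m≈s root)
        (root-square m≈s root (+-congʳ (square-cong (+-congʳ (+-congʳ (*-congˡ n≈))))))
      sign = negative-excess m+p>0 (*-nonneg _ _ (<⇒≤ factor>0) (ι-1≥0 1≤r)) (excess-eq l≈)

    distance-tests : ∀ {s} → IsSqrt ((ι n + ι 2) ^ 2 - ι 4 * ι k - ι 8) s →
                     Tests (0# ≤_) 2 (ι 0) ((ι n - ι 2 + s) / ι 2) (λ p r → p ≡ 1 ⊎ r ≡ 1)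
    distance-tests {s} root p r n≡ 1≤p 1≤r = test l≈ , proj₁ sign , corner⇔ 1≤p 1≤r ⇔-∘ proj₂ sign
      where
      l = (ι n - ι 2 + s) / ι 2
      n′ = ι p + (ι k + ι r)
      n≈ : ι n ≈ n′
      n≈ = ι-split p r n≡
      m≈s : ι 2 * (l + ι 1) - n′ ≈ s
      m≈s = shifted-root s n≈
      l≈ : l ≈ l + ι 1 - ι 1
      l≈ = solve 1 (λ l → l := l :+ con (+ 1) :- con (+ 1)) refl l
      open Parameters (ι-mono-≤ 1≤p) k≥1 (ι-mono-≤ 1≤r) using (module Distance)
      open Distance (root-≥0 m≈s root)
        (root-square m≈s root (+-congʳ (+-congʳ (square-cong (+-congʳ n≈)))))
      sign = positive-excess m>0 (*-nonneg _ _ (ι-1≥0 1≤p) (ι-1≥0 1≤r)) (excess-eq l≈)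

    distanceSignlessLaplacian-tests : ∀ {s} → IsSqrt ((ι n + ι 3) ^ 2 - ι 8 * ι k - ι 16) s →
                                      Tests (0# ≤_) 2 (ι 1) ((ι 3 * ι n - ι 3 + s) / ι 2) (λ p r → p ≡ 1)
    distanceSignlessLaplacian-tests {s} root p r n≡ 1≤p 1≤r = test l≈ , proj₁ sign , factor⇔ factor>0 1≤p ⇔-∘ proj₂ sign
      where
      l = (ι 3 * ι n - ι 3 + s) / ι 2
      n′ = ι p + (ι k + ι r)
      n≈ : ι n ≈ n′
      n≈ = ι-split p r n≡
      m≈s : ι 2 * (l - n′ + ι 2) - (n′ + ι 1) ≈ s
      m≈s = begin
        ι 2 * (l - n′ + ι 2) - (n′ + ι 1)
          ≈⟨ solve 2 (λ l n → con (+ 2) :* (l :- n :+ con (+ 2)) :- (n :+ con (+ 1)) := con (+ 2) :* l :+ con (+ 3) :- con (+ 3) :* n) refl l n′ ⟩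
        ι 2 * l + ι 3 - ι 3 * n′
          ≈⟨ +-cong (+-congʳ (half _)) (-‿cong (*-congˡ (sym n≈))) ⟩
        (ι 3 * ι n - ι 3 + s) + ι 3 - ι 3 * ι n
          ≈⟨ solve 2 (λ n s → con (+ 3) :* n :- con (+ 3) :+ s :+ con (+ 3) :- con (+ 3) :* n := s) refl (ι n) s ⟩
        s ∎
      l≈ : l ≈ l - n′ + ι 2 + n′ - ι 2
      l≈ = solve 2 (λ l n → l := l :- n :+ con (+ 2) :+ n :- con (+ 2)) refl l n′
      open Parameters (ι-mono-≤ 1≤p) k≥1 (ι-mono-≤ 1≤r) using (module DistanceSignlessLaplacian)
      open DistanceSignlessLaplacian (root-≥0 m≈s root)
        (root-square m≈s root (+-congʳ (+-congʳ (square-cong (+-congʳ n≈)))))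
      sign = positive-excess m-p>0 (*-nonneg _ _ (<⇒≤ factor>0) (ι-1≥0 1≤p)) (excess-eq l≈)

theorem4p1 :
  (ℝ : CompleteOrderedField) →
  let open CompleteOrderedField ℝ
      open Spectral ℝ
  in
  (n k : ℕ) → 1 Nat.≤ k → k Nat.+ 2 Nat.≤ n →
  (G : Digraph n) → G ∈Ω[ k ] →
  (∀ ρ s →
     IsSpectralRadius (adjacency G) ρ →
     IsSqrt ((ι n - ι 2) ^ 2 + ι 4 * ι k) s →
     (ρ ≤ (ι n - ι 2 + s) / ι 2) ×
     ((ρ ≈ (ι n - ι 2 + s) / ι 2) ⇔
       ((G ≅ K n k 1) ⊎ (G ≅ K n k (n ∸ k ∸ 1)))))
  ×
  (∀ q s →
     IsSpectralRadius (signlessLaplacian G) q →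
     IsSqrt ((ι 2 * ι n - ι k - ι 3) ^ 2 + ι 4 * ι k) s →
     (q ≤ (ι 2 * ι n + ι k - ι 3 + s) / ι 2) ×
     ((q ≈ (ι 2 * ι n + ι k - ι 3 + s) / ι 2) ⇔
       (G ≅ K n k (n ∸ k ∸ 1))))
  ×
  ((d : Fin n → Fin n → ℕ) → IsDistance G d → ∀ ρᴰ s →
     IsSpectralRadius (distance d) ρᴰ →
     IsSqrt ((ι n + ι 2) ^ 2 - ι 4 * ι k - ι 8) s →
     ((ι n - ι 2 + s) / ι 2 ≤ ρᴰ) ×
     ((ρᴰ ≈ (ι n - ι 2 + s) / ι 2) ⇔
       ((G ≅ K n k 1) ⊎ (G ≅ K n k (n ∸ k ∸ 1)))))
  ×
  ((d : Fin n → Fin n → ℕ) → IsDistance G d → ∀ qᴰ s →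
     IsSpectralRadius (distanceSignlessLaplacian d) qᴰ →
     IsSqrt ((ι n + ι 3) ^ 2 - ι 8 * ι k - ι 16) s →
     ((ι 3 * ι n - ι 3 + s) / ι 2 ≤ qᴰ) ×
     ((qᴰ ≈ (ι 3 * ι n - ι 3 + s) / ι 2) ⇔
       (G ≅ K n k 1)))
theorem4p1 ℝ n k 1≤k k+2≤n G G∈Ω =
  (λ ρ s radius root → conclude (extremal-either k+2≤n G)
    (upper (ι-nonneg 0) (adjacency-represents G) (adjacency-tests root) radius)) ,
  (λ q s radius root → conclude (extremal-R k+2≤n G)
    (upper (ι-nonneg 1) (signlessLaplacian-represents G) (signlessLaplacian-tests root) radius)) ,
  (λ d isDistance ρᴰ s radius root → conclude (extremal-either k+2≤n G)
    (lower (ι-nonneg 0) isDistance (distance-represents d) (distance-tests root) radius)) ,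
  (λ d isDistance qᴰ s radius root → conclude (extremal-P k+2≤n G)
    (lower (ι-nonneg 1) isDistance (distanceSignlessLaplacian-represents d) (distanceSignlessLaplacian-tests root) radius))
  where
  open OrderedField ℝ
  open Models ℝ
  open Assembly ℝ
  open Bounds 1≤k k+2≤n G G∈Ω
  conclude : ∀ {A B C D : Set} → C ⇔ D → A × (B ⇔ C) → A × (B ⇔ D)
  conclude C⇔D (a , B⇔C) = a , C⇔D ⇔-∘ B⇔C
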